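{- For a positive integer $n$, let $a(n)$ be the number of isomorphism classes of connected $3$-regular permutation graphs on $n$ vertices. If $n$ is odd or $n \in \{2, 8, 12\}$, then $a(n) = 0$. If $n \in \{4, 6, 10, 14, 16, 18, 20\}$, then $a(n) = 1$. For even $n > 20$, \[ a(n) = \begin{cases} a(n-4)+a(n-6) & \text{if } n\equiv 2 \pmod{4},\\ a(n-4)+a(n-6)-t\!\left(\frac{n-20}{4}\right) & \text{if } n\equiv 0 \pmod{4}, \end{cases} \] where $t(x)$ is the number of compositions of $x$ into parts of size $2$ or $3$.
   Context: All graphs are finite and simple. A graph $G$ on $n$ vertices is a permutation graph if there is a labeling $v_1, \ldots, v_n$ of its vertices and a permutation $\pi$ of $\{1,\ldots,n\}$ such that for $i<j$, the vertices $v_i$ and $v_j$ are adjacent if and only if $\pi(i) > \pi(j)$. A composition of a nonnegative integer $x$ into parts of size $2$ or $3$ is an ordered finite sequence (possibly empty, when $x=0$) of elements of $\{2,3\}$ summing to $x$. -}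

module Defs where

open import Data.Nat using (ℕ; zero; suc; _+_)
open import Data.Bool using (Bool; true; false; if_then_else_)
open import Data.Fin using (Fin; _<_; _>_)
open import Data.Fin.Permutation using (Permutation′; _⟨$⟩ʳ_)
open import Data.List using (List; map; allFin)
open import Data.Nat.ListAction using (sum)
open import Data.List.Relation.Unary.All using (All)
open import Data.Product using (Σ; ∃; _×_; _,_)
open import Data.Sum using (_⊎_)
open import Function.Bundles using (_⇔_)
open import Relation.Binary.PropositionalEquality using (_≡_)

record Graph (n : ℕ) : Set where
  field
    adj   : Fin n → Fin n → Bool
    sym   : ∀ i j → adj i j ≡ adj j i
    irrefl : ∀ i → adj i i ≡ false
open Graph public

Adj : ∀ {n} → Graph n → Fin n → Fin n → Set
Adj G i j = adj G i j ≡ true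

Iso : ∀ {n} → Graph n → Graph n → Set
Iso {n} G H = Σ (Permutation′ n) λ σ →
  ∀ i j → adj G i j ≡ adj H (σ ⟨$⟩ʳ i) (σ ⟨$⟩ʳ j)

degree : ∀ {n} → Graph n → Fin n → ℕ
degree {n} G i = sum (map (λ j → if adj G i j then 1 else 0) (allFin n))

ThreeRegular : ∀ {n} → Graph n → Set
ThreeRegular G = ∀ i → degree G i ≡ 3

data Reach {n} (G : Graph n) : Fin n → Fin n → Set where
  here : ∀ {i} → Reach G i i
  step : ∀ {i k j} → Adj G i k → Reach G k j → Reach G i j

Connected : ∀ {n} → Graph n → Set
Connected G = ∀ i j → Reach G i j

IsPermutationGraph : ∀ {n} → Graph n → Set
IsPermutationGraph {n} G = Σ (Permutation′ n) λ v → Σ (Permutation′ n) λ π →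
  ∀ (i j : Fin n) → i < j →
    (Adj G (v ⟨$⟩ʳ i) (v ⟨$⟩ʳ j) ⇔ (π ⟨$⟩ʳ i) > (π ⟨$⟩ʳ j))

CountUpTo : {A : Set} → (A → Set) → (A → A → Set) → ℕ → Set
CountUpTo {A} P _~_ k = Σ (Fin k → A) λ f →
  (∀ i → P (f i)) ×
  (∀ i j → f i ~ f j → i ≡ j) ×
  (∀ x → P x → ∃ λ i → x ~ f i)

CubicConnPerm : ∀ {n} → Graph n → Set
CubicConnPerm G = Connected G × ThreeRegular G × IsPermutationGraph G

NumCubicPermClasses : ℕ → ℕ → Set
NumCubicPermClasses n k = CountUpTo (CubicConnPerm {n}) Iso k

IsComposition23 : ℕ → List ℕ → Set
IsComposition23 x ps = All (λ p → p ≡ 2 ⊎ p ≡ 3) ps × sum ps ≡ x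

NumCompositions23 : ℕ → ℕ → Set
NumCompositions23 x k = CountUpTo (IsComposition23 x) _≡_ k

{-# OPTIONS --safe #-}
-- Scan a permutation representing a connected cubic graph from left to right,
-- remembering only which values above the smallest unused value k have been
-- used.  Every entry lies in exactly three inversions, so the next value k + p
-- must satisfy  #(unused below) + #(used above) = 3, and at most three used
-- values lie above k.  This leaves 18 patterns, and following the transitions
-- shows that the graph is K₄, K₃,₃ or a chain: blocks K₄ − e and K₃,₃ − e strung
-- together by bridges, closed at both ends by K₄ with a subdivided edge.  The
-- scan only has to provide an injective homomorphism from the chain: between
-- cubic graphs with connected target this is already an isomorphism.
--
-- The sequence of blocks can be read off the graph once an end is chosen, so
-- chains are classified by words in the two kinds of blocks up to reversal, a
-- word of weight m (blocks weigh 2 and 3) giving 10 + 2m vertices.  Removing the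
-- first and the last letter yields, for the number A(m) of words up to reversal
-- and the number t(m) of all words,  A(m) = A(m − 4) + A(m − 6) + t(m − 5),
-- from which the recurrences follow by induction.
module Submission where

open import Defs
open import Data.Bool using (Bool; true; false; if_then_else_; _∧_; _∨_)
open import Data.Empty using (⊥; ⊥-elim)
open import Data.Fin using (Fin; zero; suc; toℕ; fromℕ<; _↑ˡ_; _↑ʳ_; splitAt; join)
open import Data.Fin.Patterns using (0F; 1F; 2F; 3F; 4F; 5F)
open import Data.Fin.Permutation using (Permutation′; permutation; flip; _∘ₚ_; _⟨$⟩ʳ_; _⟨$⟩ˡ_; inverseˡ; inverseʳ)
open import Data.List using (List; []; _∷_; _++_; length; map; filter; allFin; tabulate; reverse; _ʳ++_; _∷ʳ_; catMaybes; initLast; _∷ʳ′_)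
open import Data.List.Membership.Propositional using (_∈_)
open import Data.List.Membership.Propositional.Properties using (∈-map⁺; ∈-map⁻; ∈-filter⁺; ∈-filter⁻; ∈-allFin; ∈-++⁺ˡ; ∈-++⁺ʳ; ∈-++⁻; ∈-∃++)
open import Data.List.Relation.Unary.All as All using (All; []; _∷_)
open import Data.List.Relation.Unary.AllPairs using ([]; _∷_)
open import Data.List.Relation.Unary.Any using (there) renaming (here to here∈)
open import Data.List.Relation.Unary.Unique.Propositional using (Unique)
open import Data.Maybe using (Maybe; just; nothing)
open import Data.Nat using (ℕ; zero; suc; _+_; _*_; _∸_; _≤_; _<_; _/_; _%_; z≤n; s≤s)
open import Data.Nat.DivMod using (m≡m%n+[m/n]*n; m*n/n≡m; m*n%n≡0)
open import Data.Nat.Properties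
open import Data.Nat.Tactic.RingSolver using (solve-∀)
open import Data.Product using (Σ; ∃; _×_; _,_; proj₁; proj₂; swap)
open import Data.Sum using (_⊎_; inj₁; inj₂)
open import Data.Vec using (Vec; []; _∷_; lookup)
open import Function using (_∘_; id)
open import Function.Bundles using (_⇔_; mk⇔; module Equivalence)
open import Relation.Binary.Definitions using (tri<; tri≈; tri>)
open import Relation.Binary.PropositionalEquality using (_≡_; _≢_; refl; trans; cong; cong₂; subst; subst₂; module ≡-Reasoning) renaming (sym to ≡-sym)
open import Relation.Nullary using (¬_; Dec; yes; no; contradiction)
open import Relation.Nullary.Decidable using (does; from-yes; From-yes; dec-true; _→-dec_; _⊎-dec_; _×-dec_; ¬?)
import Data.Bool.Properties as Bool
import Data.Fin.Properties as Fin
import Data.List.Properties as List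
import Data.List.Relation.Unary.All.Properties as All
import Data.List.Relation.Unary.Unique.Propositional.Properties as Unique
import Data.Nat.ListAction as ℕ
import Data.Sum

-- The term subtracted for n ≡ 0 (mod 4) is due to palindromes. Twice the number of words up to
-- reversal is t(m) plus the number of palindromes of weight m. Here t satisfies f(m) = f(m - 2) +
-- f(m - 3); the palindromes satisfy it for even m ≥ 6, but for odd m ≥ 5 they fall short by 2 t((m
-- - 5)/2). With n = 10 + 2m the lags 2 and 3 become 4 and 6, and (m - 5)/2 becomes (n - 20)/4.
-- Removing both end letters avoids the halving.
--
-- Two kinds of bridge shape the scan. Either the near end is scanned before anything beyond the
-- bridge, or the far end comes just before the near end. A block `three` keeps the kind and a block
-- `two` exchanges it, hence two mutually recursive scans, and hence a swap of coordinates in the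
-- converse construction. With the second kind, the times of consecutive pieces interleave, so
-- disjointness of the pieces is controlled by recording their times.

private variable
  m n : ℕ

-- Degrees as lengths of duplicate-free lists.

unique⊆⇒length≤ : {A : Set} {xs ys : List A} → Unique xs → (∀ {x} → x ∈ xs → x ∈ ys) → length xs ≤ length ys
unique⊆⇒length≤ {xs = []} _ _ = z≤n
unique⊆⇒length≤ {xs = x ∷ xs} (x≢ ∷ uxs) sub with ∈-∃++ (sub (here∈ refl))
... | as , bs , refl = subst (suc (length xs) ≤_) (≡-sym eq) (s≤s (unique⊆⇒length≤ uxs sub′))
  where
  eq : length (as ++ x ∷ bs) ≡ suc (length (as ++ bs))
  eq = trans (List.length-++ as) (trans (+-suc _ _) (cong suc (≡-sym (List.length-++ as))))
  sub′ : ∀ {y} → y ∈ xs → y ∈ as ++ bs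
  sub′ y∈ with ∈-++⁻ as (sub (there y∈))
  ... | inj₁ y∈as = ∈-++⁺ˡ y∈as
  ... | inj₂ (here∈ refl) = contradiction refl (All.lookup x≢ y∈)
  ... | inj₂ (there y∈bs) = ∈-++⁺ʳ as y∈bs

neighbours : Graph n → Fin n → List (Fin n)
neighbours {n} G v = filter (λ u → adj G v u Bool.≟ true) (allFin n)

length-neighbours : (G : Graph n) (v : Fin n) → length (neighbours G v) ≡ degree G v
length-neighbours {n} G v = go (allFin n)
  where
  go : ∀ us → length (filter (λ u → adj G v u Bool.≟ true) us) ≡ ℕ.sum (map (λ u → if adj G v u then 1 else 0) us)
  go [] = refl
  go (u ∷ us) with adj G v u
  ... | true = cong suc (go us)
  ... | false = go us

unique-neighbours : (G : Graph n) (v : Fin n) → Unique (neighbours G v)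
unique-neighbours {n} G v = Unique.filter⁺ (λ u → adj G v u Bool.≟ true) (Unique.allFin⁺ n)

∈-neighbours⁺ : (G : Graph n) {v u : Fin n} → Adj G v u → u ∈ neighbours G v
∈-neighbours⁺ G {v} {u} a = ∈-filter⁺ (λ u → adj G v u Bool.≟ true) (∈-allFin u) a

∈-neighbours⁻ : (G : Graph n) {v u : Fin n} → u ∈ neighbours G v → Adj G v u
∈-neighbours⁻ {n} G {v} u∈ = proj₂ (∈-filter⁻ (λ u → adj G v u Bool.≟ true) {xs = allFin n} u∈)

length≤degree : (G : Graph n) {v : Fin n} {us : List (Fin n)} → Unique us → All (Adj G v) us → length us ≤ degree G v
length≤degree G {v} uus as = subst (_ ≤_) (length-neighbours G v)
  (unique⊆⇒length≤ uus (λ u∈ → ∈-neighbours⁺ G (All.lookup as u∈)))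

Adj-sym : (G : Graph n) {u v : Fin n} → Adj G u v → Adj G v u
Adj-sym G {u} {v} a = trans (sym G v u) a

Adj⇒≢ : (G : Graph n) {u v : Fin n} → Adj G u v → u ≢ v
Adj⇒≢ G {u} a refl = Bool.not-¬ (trans (≡-sym a) (irrefl G u)) refl

neighbours-only : (G : Graph n) → ThreeRegular G → ∀ {v a b c d} →
  Adj G v a → Adj G v b → Adj G v c → a ≢ b → a ≢ c → b ≢ c →
  Adj G v d → d ≡ a ⊎ d ≡ b ⊎ d ≡ c
neighbours-only G cubic {v} {a} {b} {c} {d} va vb vc a≢b a≢c b≢c vd
  with d Fin.≟ a | d Fin.≟ b | d Fin.≟ c
... | yes e | _ | _ = inj₁ e
... | no _ | yes e | _ = inj₂ (inj₁ e)
... | no _ | no _ | yes e = inj₂ (inj₂ e)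
... | no d≢a | no d≢b | no d≢c = contradiction (subst (4 ≤_) (cubic v) 4≤) λ { (s≤s (s≤s (s≤s ()))) }
  where
  4≤ : 4 ≤ degree G v
  4≤ = length≤degree G
    ((d≢a ∷ d≢b ∷ d≢c ∷ []) ∷ (a≢b ∷ a≢c ∷ []) ∷ (b≢c ∷ []) ∷ [] ∷ [])
    (vd ∷ va ∷ vb ∷ vc ∷ [])

-- Injective homomorphisms between cubic graphs.

Injective : {A B : Set} → (A → B) → Set
Injective f = ∀ {x y} → f x ≡ f y → x ≡ y

-- Otherwise `y` and the values of `f` would be n + 1 distinct elements of `Fin n`.
injective⇒surjective : (f : Fin n → Fin n) → Injective f → ∀ y → ∃ λ x → f x ≡ y
injective⇒surjective {n} f inj y with Fin.any? (λ x → f x Fin.≟ y)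
... | yes p = p
... | no ∄ = contradiction (unique⊆⇒length≤ {ys = allFin n} uniq (λ _ → ∈-allFin _)) (<⇒≱ (≤-reflexive lengths))
  where
  uniq : Unique (y ∷ map f (allFin n))
  uniq = All.tabulate (λ z∈ y≡z → let (x , _ , z≡) = ∈-map⁻ f z∈ in ∄ (x , ≡-sym (trans y≡z z≡)))
    ∷ Unique.map⁺ inj (Unique.allFin⁺ n)
  lengths : suc (length (allFin n)) ≡ length (y ∷ map f (allFin n))
  lengths = cong suc (≡-sym (List.length-map f (allFin n)))

-- The source is a bare type with a relation, so that pieces of a chain can be sum types. Non-edges
-- need not be preserved; cubicity supplies that in `embedding⇒Iso`.
record Embedding {V : Set} (_∼_ : V → V → Set) (G : Graph n) : Set where
  field
    fun : V → Fin n
    injective : Injective fun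
    hom : ∀ {u v} → u ∼ v → Adj G (fun u) (fun v)
open Embedding

-- The three neighbours of u already fill up the degree of the image of u.
lift-neighbour : (G : Graph m) (H : Graph n) → ThreeRegular G → ThreeRegular H →
  (φ : Embedding (Adj G) H) → ∀ {u h} → Adj H (fun φ u) h → ∃ λ v → Adj G u v × fun φ v ≡ h
lift-neighbour {m} G H cubG cubH φ {u} {h} a
  with Fin.any? (λ v → fun φ v Fin.≟ h)
... | no ∄ = contradiction (subst₂ _≤_ (cong suc (trans (List.length-map (fun φ) (neighbours G u)) (trans (length-neighbours G u) (cubG u)))) (cubH (fun φ u)) 4≤) λ { (s≤s (s≤s (s≤s ()))) }
  where
  4≤ : length (h ∷ map (fun φ) (neighbours G u)) ≤ degree H (fun φ u)
  4≤ = length≤degree H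
    (All.tabulate (λ z∈ h≡z → let (x , _ , z≡) = ∈-map⁻ (fun φ) z∈ in ∄ (x , ≡-sym (trans h≡z z≡)))
      ∷ Unique.map⁺ (injective φ) (unique-neighbours G u))
    (a ∷ All.map⁺ (All.tabulate (λ v∈ → hom φ (∈-neighbours⁻ G v∈))))
... | yes (v , refl) with adj G u v in eq
...   | true = v , eq , refl
...   | false = contradiction (subst₂ _≤_ (cong suc (trans (List.length-map (fun φ) (neighbours G u)) (trans (length-neighbours G u) (cubG u)))) (cubH (fun φ u)) 4≤) λ { (s≤s (s≤s (s≤s ()))) }
  where
  4≤ : length (fun φ v ∷ map (fun φ) (neighbours G u)) ≤ degree H (fun φ u)
  4≤ = length≤degree H
    (Unique.map⁺ (injective φ) {xs = v ∷ neighbours G u}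
      (All.tabulate (λ z∈ v≡z → Bool.not-¬ (trans (≡-sym (∈-neighbours⁻ G z∈)) (trans (cong (adj G u) (≡-sym v≡z)) eq)) refl)
        ∷ unique-neighbours G u))
    (a ∷ All.map⁺ (All.tabulate (λ v∈ → hom φ (∈-neighbours⁻ G v∈))))

-- By `lift-neighbour` the image is closed under adjacency, so a walk that starts in it never leaves
-- it.
embedding-surjective : (G : Graph m) (H : Graph n) → ThreeRegular G → ThreeRegular H → Connected H →
  (φ : Embedding (Adj G) H) → Fin m → ∀ h → ∃ λ v → fun φ v ≡ h
embedding-surjective G H cubG cubH conn φ o h = go (conn (fun φ o) h) (o , refl)
  where
  go : ∀ {a b} → Reach H a b → (∃ λ v → fun φ v ≡ a) → ∃ λ v → fun φ v ≡ b
  go here p = p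
  go (step a r) (v , refl) with lift-neighbour G H cubG cubH φ a
  ... | w , _ , e = go r (w , e)

embedding⇒≡ : (G : Graph m) (H : Graph n) → ThreeRegular G → ThreeRegular H → Connected H →
  Embedding (Adj G) H → Fin m → m ≡ n
embedding⇒≡ G H cubG cubH conn φ o = ≤-antisym (Fin.injective⇒≤ {f = fun φ} (injective φ))
  (Fin.injective⇒≤ {f = λ h → proj₁ (surj h)} (λ {x} {y} e → trans (≡-sym (proj₂ (surj x))) (trans (cong (fun φ) e) (proj₂ (surj y)))))
  where surj = embedding-surjective G H cubG cubH conn φ o

-- Equal orders give bijectivity. An edge between two images lifts to an edge at `i`, and
-- injectivity identifies its other end as `j`.
embedding⇒Iso : (G H : Graph n) → ThreeRegular G → ThreeRegular H → Embedding (Adj G) H → Iso G H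
embedding⇒Iso G H cubG cubH φ = permutation f (proj₁ ∘ surj) (proj₂ ∘ surj) (λ i → injective φ (proj₂ (surj (f i)))) , pres
  where
  f = fun φ
  surj = injective⇒surjective f (injective φ)
  pres : ∀ i j → adj G i j ≡ adj H (f i) (f j)
  pres i j with adj G i j in e | adj H (f i) (f j) in e′
  ... | true | true = refl
  ... | false | false = refl
  ... | true | false = trans (≡-sym (hom φ e)) e′
  ... | false | true with lift-neighbour G H cubG cubH φ e′
  ...   | k , a , fk≡fj with injective φ fk≡fj
  ...     | refl = trans (≡-sym e) a

-- Chains of blocks.

data Block : Set where
  two three : Block

order : Block → ℕ
order two = 4
order three = 6

table : {s : ℕ} → List (Fin s × Fin s) → Fin s → Fin s → Bool
table [] u v = false
table ((a , b) ∷ es) u v =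
  ((does (a Fin.≟ u) ∧ does (b Fin.≟ v)) ∨ (does (a Fin.≟ v) ∧ does (b Fin.≟ u))) ∨ table es u v

table-sym : {s : ℕ} (es : List (Fin s × Fin s)) (u v : Fin s) → table es u v ≡ table es v u
table-sym [] u v = refl
table-sym ((a , b) ∷ es) u v = cong₂ _∨_ (Bool.∨-comm (does (a Fin.≟ u) ∧ does (b Fin.≟ v)) _) (table-sym es u v)

EdgesIn : {s : ℕ} (G : Graph n) → (Fin s → Fin n) → List (Fin s × Fin s) → Set
EdgesIn G f = All (λ e → Adj G (f (proj₁ e)) (f (proj₂ e)))

table-hom : {s : ℕ} (G : Graph n) (f : Fin s → Fin n) {es : List (Fin s × Fin s)} →
  EdgesIn G f es → ∀ {u v} → table es u v ≡ true → Adj G (f u) (f v)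
table-hom G f {(a , b) ∷ es} (e ∷ as) {u} {v} p
  with a Fin.≟ u | b Fin.≟ v | a Fin.≟ v | b Fin.≟ u
... | yes refl | yes refl | _ | _ = e
... | yes _ | no _ | yes refl | yes refl = Adj-sym G e
... | yes _ | no _ | yes _ | no _ = table-hom G f as p
... | yes _ | no _ | no _ | _ = table-hom G f as p
... | no _ | _ | yes refl | yes refl = Adj-sym G e
... | no _ | _ | yes _ | no _ = table-hom G f as p
... | no _ | _ | no _ | _ = table-hom G f as p

-- K₄ with a subdivided edge; 0 is the subdividing vertex.
endEdges : List (Fin 5 × Fin 5)
endEdges = (0F , 1F) ∷ (0F , 2F) ∷ (1F , 3F) ∷ (1F , 4F) ∷ (2F , 3F) ∷ (2F , 4F) ∷ (3F , 4F) ∷ []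

-- K₄ and K₃,₃ minus the edge joining the entry to the exit.
edges : (b : Block) → List (Fin (order b) × Fin (order b))
edges two = (0F , 1F) ∷ (0F , 2F) ∷ (1F , 2F) ∷ (1F , 3F) ∷ (2F , 3F) ∷ []
edges three = (0F , 1F) ∷ (0F , 2F) ∷ (1F , 3F) ∷ (1F , 4F) ∷ (2F , 3F) ∷ (2F , 4F) ∷ (3F , 5F) ∷ (4F , 5F) ∷ []

entry exit : (b : Block) → Fin (order b)
entry two = 0F
entry three = 0F
exit two = 3F
exit three = 5F

isEntry isExit : (b : Block) → Fin (order b) → Bool
isEntry b u = does (u Fin.≟ entry b)
isExit b u = does (u Fin.≟ exit b)

-- What lies on one side of a bridge. The `root` is the end of that bridge and has degree 2 within
-- the tail; the empty word leaves just the end piece.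
Tail : List Block → Set
Tail [] = Fin 5
Tail (b ∷ l) = Fin (order b) ⊎ Tail l

root : ∀ l → Tail l
root [] = 0F
root (b ∷ l) = inj₁ (entry b)

isRoot : ∀ l → Tail l → Bool
isRoot [] u = does (u Fin.≟ 0F)
isRoot (b ∷ l) (inj₁ u) = isEntry b u
isRoot (b ∷ l) (inj₂ u) = false

isRoot-root : ∀ l → isRoot l (root l) ≡ true
isRoot-root [] = refl
isRoot-root (two ∷ l) = refl
isRoot-root (three ∷ l) = refl

isRoot⇒≡ : ∀ l {u} → isRoot l u ≡ true → u ≡ root l
isRoot⇒≡ [] {u} p with u Fin.≟ 0F
... | yes e = e
isRoot⇒≡ (b ∷ l) {inj₁ u} p with u Fin.≟ entry b
... | yes e = cong inj₁ e

adjT : ∀ l → Tail l → Tail l → Bool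
adjT [] u v = table endEdges u v
adjT (b ∷ l) (inj₁ u) (inj₁ v) = table (edges b) u v
adjT (b ∷ l) (inj₁ u) (inj₂ v) = isExit b u ∧ isRoot l v
adjT (b ∷ l) (inj₂ u) (inj₁ v) = isExit b v ∧ isRoot l u
adjT (b ∷ l) (inj₂ u) (inj₂ v) = adjT l u v

-- A chain seen from one chosen bridge. Chains proper have `[]` on the left; the general form lets
-- the bridge travel along the chain when it is reversed.
Joined : List Block → List Block → Set
Joined a b = Tail a ⊎ Tail b

adjJ : ∀ a b → Joined a b → Joined a b → Bool
adjJ a b (inj₁ u) (inj₁ v) = adjT a u v
adjJ a b (inj₁ u) (inj₂ v) = isRoot a u ∧ isRoot b v
adjJ a b (inj₂ u) (inj₁ v) = isRoot a v ∧ isRoot b u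
adjJ a b (inj₂ u) (inj₂ v) = adjT b u v

adjT-sym : ∀ l u v → adjT l u v ≡ adjT l v u
adjT-sym [] u v = table-sym endEdges u v
adjT-sym (b ∷ l) (inj₁ u) (inj₁ v) = table-sym (edges b) u v
adjT-sym (b ∷ l) (inj₁ u) (inj₂ v) = refl
adjT-sym (b ∷ l) (inj₂ u) (inj₁ v) = refl
adjT-sym (b ∷ l) (inj₂ u) (inj₂ v) = adjT-sym l u v

adjJ-sym : ∀ a b u v → adjJ a b u v ≡ adjJ a b v u
adjJ-sym a b (inj₁ u) (inj₁ v) = adjT-sym a u v
adjJ-sym a b (inj₁ u) (inj₂ v) = refl
adjJ-sym a b (inj₂ u) (inj₁ v) = refl
adjJ-sym a b (inj₂ u) (inj₂ v) = adjT-sym b u v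

end-irrefl : ∀ u → table endEdges u u ≡ false
end-irrefl = from-yes (Fin.all? λ u → table endEdges u u Bool.≟ false)

block-irrefl : ∀ b u → table (edges b) u u ≡ false
block-irrefl two = from-yes (Fin.all? λ u → table (edges two) u u Bool.≟ false)
block-irrefl three = from-yes (Fin.all? λ u → table (edges three) u u Bool.≟ false)

adjT-irrefl : ∀ l u → adjT l u u ≡ false
adjT-irrefl [] u = end-irrefl u
adjT-irrefl (b ∷ l) (inj₁ u) = block-irrefl b u
adjT-irrefl (b ∷ l) (inj₂ u) = adjT-irrefl l u

adjJ-irrefl : ∀ a b u → adjJ a b u u ≡ false
adjJ-irrefl a b (inj₁ u) = adjT-irrefl a u
adjJ-irrefl a b (inj₂ u) = adjT-irrefl b u

tailSize : List Block → ℕ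
tailSize [] = 5
tailSize (b ∷ l) = order b + tailSize l

encode : ∀ l → Tail l → Fin (tailSize l)
encode [] u = u
encode (b ∷ l) (inj₁ u) = u ↑ˡ tailSize l
encode (b ∷ l) (inj₂ u) = order b ↑ʳ encode l u

decode : ∀ l → Fin (tailSize l) → Tail l
decode [] u = u
decode (b ∷ l) i = Data.Sum.map₂ (decode l) (splitAt (order b) i)

decode-encode : ∀ l u → decode l (encode l u) ≡ u
decode-encode [] u = refl
decode-encode (b ∷ l) (inj₁ u) rewrite Fin.splitAt-↑ˡ (order b) u (tailSize l) = refl
decode-encode (b ∷ l) (inj₂ u) rewrite Fin.splitAt-↑ʳ (order b) (tailSize l) (encode l u) = cong inj₂ (decode-encode l u)

encode-decode : ∀ l i → encode l (decode l i) ≡ i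
encode-decode [] u = refl
encode-decode (b ∷ l) i with splitAt (order b) i in eq
... | inj₁ u = Fin.splitAt⁻¹-↑ˡ eq
... | inj₂ u = trans (cong (order b ↑ʳ_) (encode-decode l u)) (Fin.splitAt⁻¹-↑ʳ eq)

encodeJ : ∀ a b → Joined a b → Fin (tailSize a + tailSize b)
encodeJ a b (inj₁ u) = encode a u ↑ˡ tailSize b
encodeJ a b (inj₂ u) = tailSize a ↑ʳ encode b u

decodeJ : ∀ a b → Fin (tailSize a + tailSize b) → Joined a b
decodeJ a b i = Data.Sum.map (decode a) (decode b) (splitAt (tailSize a) i)

decodeJ-encodeJ : ∀ a b u → decodeJ a b (encodeJ a b u) ≡ u
decodeJ-encodeJ a b (inj₁ u) rewrite Fin.splitAt-↑ˡ (tailSize a) (encode a u) (tailSize b) = cong inj₁ (decode-encode a u)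
decodeJ-encodeJ a b (inj₂ u) rewrite Fin.splitAt-↑ʳ (tailSize a) (tailSize b) (encode b u) = cong inj₂ (decode-encode b u)

encodeJ-decodeJ : ∀ a b i → encodeJ a b (decodeJ a b i) ≡ i
encodeJ-decodeJ a b i with splitAt (tailSize a) i in eq
... | inj₁ u = trans (cong (_↑ˡ tailSize b) (encode-decode a u)) (Fin.splitAt⁻¹-↑ˡ eq)
... | inj₂ u = trans (cong (tailSize a ↑ʳ_) (encode-decode b u)) (Fin.splitAt⁻¹-↑ʳ eq)

joined : ∀ a b → Graph (tailSize a + tailSize b)
adj (joined a b) i j = adjJ a b (decodeJ a b i) (decodeJ a b j)
sym (joined a b) i j = adjJ-sym a b (decodeJ a b i) (decodeJ a b j)
irrefl (joined a b) i = adjJ-irrefl a b (decodeJ a b i)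

TailAdj : ∀ l → Tail l → Tail l → Set
TailAdj l u v = adjT l u v ≡ true

JoinedAdj : ∀ a b → Joined a b → Joined a b → Set
JoinedAdj a b u v = adjJ a b u v ≡ true

encoding : ∀ a b → Embedding (JoinedAdj a b) (joined a b)
fun (encoding a b) = encodeJ a b
injective (encoding a b) {u} {v} e = trans (≡-sym (decodeJ-encodeJ a b u)) (trans (cong (decodeJ a b) e) (decodeJ-encodeJ a b v))
hom (encoding a b) {u} {v} p = trans (cong₂ (adjJ a b) (decodeJ-encodeJ a b u) (decodeJ-encodeJ a b v)) p

along-decodeJ : ∀ a b {G : Graph n} → Embedding (JoinedAdj a b) G → Embedding (Adj (joined a b)) G
fun (along-decodeJ a b φ) = fun φ ∘ decodeJ a b
injective (along-decodeJ a b φ) {i} {j} e = trans (≡-sym (encodeJ-decodeJ a b i)) (trans (cong (encodeJ a b) (injective φ e)) (encodeJ-decodeJ a b j))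
hom (along-decodeJ a b φ) = hom φ

restrict : ∀ b l {G : Graph n} → Embedding (TailAdj (b ∷ l)) G → Embedding (TailAdj l) G
fun (restrict b l φ) = fun φ ∘ inj₂
injective (restrict b l φ) e with injective φ e
... | refl = refl
hom (restrict b l φ) = hom φ

leftPart : ∀ a b {G : Graph n} → Embedding (JoinedAdj a b) G → Embedding (TailAdj a) G
fun (leftPart a b φ) = fun φ ∘ inj₁
injective (leftPart a b φ) e with injective φ e
... | refl = refl
hom (leftPart a b φ) = hom φ

rightPart : ∀ a b {G : Graph n} → Embedding (JoinedAdj a b) G → Embedding (TailAdj b) G
fun (rightPart a b φ) = fun φ ∘ inj₂
injective (rightPart a b φ) e with injective φ e
... | refl = refl
hom (rightPart a b φ) = hom φ

roots-adjacent : ∀ a b → JoinedAdj a b (inj₁ (root a)) (inj₂ (root b))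
roots-adjacent a b = cong₂ _∧_ (isRoot-root a) (isRoot-root b)

exit-adjacent : ∀ b l → TailAdj (b ∷ l) (inj₁ (exit b)) (inj₂ (root l))
exit-adjacent b l = cong₂ _∧_ (dec-true (exit b Fin.≟ exit b) refl) (isRoot-root l)

-- Degrees and connectedness of chains.

sumFin : ∀ n → (Fin n → ℕ) → ℕ
sumFin n f = ℕ.sum (map f (allFin n))

sumFin-tabulate : ∀ n (f : Fin n → ℕ) → sumFin n f ≡ ℕ.sum (tabulate f)
sumFin-tabulate n f = cong ℕ.sum (List.map-tabulate id f)

sumFin-cong : ∀ n {f g : Fin n → ℕ} → (∀ i → f i ≡ g i) → sumFin n f ≡ sumFin n g
sumFin-cong n eq = cong ℕ.sum (List.map-cong eq (allFin n))

sumFin-+ : ∀ m n (f : Fin (m + n) → ℕ) → sumFin (m + n) f ≡ sumFin m (λ i → f (i ↑ˡ n)) + sumFin n (λ i → f (m ↑ʳ i))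
sumFin-+ m n f = trans (sumFin-tabulate (m + n) f) (trans (go m f) (≡-sym (cong₂ _+_ (sumFin-tabulate m _) (sumFin-tabulate n _))))
  where
  go : ∀ m (f : Fin (m + n) → ℕ) → ℕ.sum (tabulate f) ≡ ℕ.sum (tabulate (λ i → f (i ↑ˡ n))) + ℕ.sum (tabulate (λ i → f (m ↑ʳ i)))
  go zero f = refl
  go (suc m) f = trans (cong (f zero +_) (go m (f ∘ suc))) (≡-sym (+-assoc (f zero) _ _))

indicator : Bool → ℕ
indicator c = if c then 1 else 0

sumTail : ∀ l → (Tail l → ℕ) → ℕ
sumTail l f = sumFin (tailSize l) (f ∘ decode l)

sumTail-∷ : ∀ b l (f : Tail (b ∷ l) → ℕ) → sumTail (b ∷ l) f ≡ sumFin (order b) (f ∘ inj₁) + sumTail l (f ∘ inj₂)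
sumTail-∷ b l f = trans (sumFin-+ (order b) (tailSize l) _) (cong₂ _+_
  (sumFin-cong (order b) (λ i → cong (f ∘ Data.Sum.map₂ (decode l)) (Fin.splitAt-↑ˡ (order b) i (tailSize l))))
  (sumFin-cong (tailSize l) (λ i → cong (f ∘ Data.Sum.map₂ (decode l)) (Fin.splitAt-↑ʳ (order b) (tailSize l) i))))

sumJoined : ∀ a b (f : Joined a b → ℕ) → sumFin (tailSize a + tailSize b) (f ∘ decodeJ a b) ≡ sumTail a (f ∘ inj₁) + sumTail b (f ∘ inj₂)
sumJoined a b f = trans (sumFin-+ (tailSize a) (tailSize b) _) (cong₂ _+_
  (sumFin-cong (tailSize a) (λ i → cong (f ∘ Data.Sum.map (decode a) (decode b)) (Fin.splitAt-↑ˡ (tailSize a) i (tailSize b))))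
  (sumFin-cong (tailSize b) (λ i → cong (f ∘ Data.Sum.map (decode a) (decode b)) (Fin.splitAt-↑ʳ (tailSize a) (tailSize b) i))))

sumTail-0 : ∀ l → sumTail l (λ _ → 0) ≡ 0
sumTail-0 [] = refl
sumTail-0 (two ∷ l) = trans (sumTail-∷ two l (λ _ → 0)) (sumTail-0 l)
sumTail-0 (three ∷ l) = trans (sumTail-∷ three l (λ _ → 0)) (sumTail-0 l)

sumTail-isRoot : ∀ l → sumTail l (indicator ∘ isRoot l) ≡ 1
sumTail-isRoot [] = refl
sumTail-isRoot (two ∷ l) = trans (sumTail-∷ two l (indicator ∘ isRoot (two ∷ l))) (cong suc (sumTail-0 l))
sumTail-isRoot (three ∷ l) = trans (sumTail-∷ three l (indicator ∘ isRoot (three ∷ l))) (cong suc (sumTail-0 l))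

sumTail-∧-isRoot : ∀ l c → sumTail l (λ v → indicator (c ∧ isRoot l v)) ≡ indicator c
sumTail-∧-isRoot l true = sumTail-isRoot l
sumTail-∧-isRoot l false = sumTail-0 l

sumTail-isRoot-∧ : ∀ l c → sumTail l (λ v → indicator (isRoot l v ∧ c)) ≡ indicator c
sumTail-isRoot-∧ l c = trans (sumFin-cong (tailSize l) (λ i → cong indicator (Bool.∧-comm (isRoot l (decode l i)) c))) (sumTail-∧-isRoot l c)

sum-isExit-∧ : ∀ b c → sumFin (order b) (λ u → indicator (isExit b u ∧ c)) ≡ indicator c
sum-isExit-∧ two c = +-identityʳ _
sum-isExit-∧ three c = +-identityʳ _

-- Inside a block, entry and exit each have degree 2; the indicators stand for the two bridges.
block-degree : ∀ b u → sumFin (order b) (λ v → indicator (table (edges b) u v)) + indicator (isExit b u) + indicator (isEntry b u) ≡ 3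
block-degree two = from-yes (Fin.all? λ u →
  sumFin (order two) (λ v → indicator (table (edges two) u v)) + indicator (isExit two u) + indicator (isEntry two u) ≟ 3)
block-degree three = from-yes (Fin.all? λ u →
  sumFin (order three) (λ v → indicator (table (edges three) u v)) + indicator (isExit three u) + indicator (isEntry three u) ≟ 3)

end-degree : ∀ u → sumFin 5 (λ v → indicator (table endEdges u v)) + indicator (isRoot [] u) ≡ 3
end-degree = from-yes (Fin.all? λ u → sumFin 5 (λ v → indicator (table endEdges u v)) + indicator (isRoot [] u) ≟ 3)

tail-degree : ∀ l u → sumTail l (λ v → indicator (adjT l u v)) + indicator (isRoot l u) ≡ 3
tail-degree [] u = end-degree u
tail-degree (b ∷ l) (inj₁ u) = trans
  (cong (_+ indicator (isEntry b u)) (trans (sumTail-∷ b l (λ v → indicator (adjT (b ∷ l) (inj₁ u) v)))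
    (cong (sumFin (order b) (λ v → indicator (table (edges b) u v)) +_) (sumTail-∧-isRoot l (isExit b u)))))
  (block-degree b u)
tail-degree (b ∷ l) (inj₂ u) = trans (+-identityʳ _) (trans (sumTail-∷ b l (λ v → indicator (adjT (b ∷ l) (inj₂ u) v)))
  (trans (cong (_+ sumTail l (λ v → indicator (adjT l u v))) (sum-isExit-∧ b (isRoot l u)))
  (trans (+-comm (indicator (isRoot l u)) _) (tail-degree l u))))

joined-cubic : ∀ a b → ThreeRegular (joined a b)
joined-cubic a b i with decodeJ a b i
... | inj₁ u = trans (sumJoined a b (λ v → indicator (adjJ a b (inj₁ u) v)))
  (trans (cong (sumTail a (λ v → indicator (adjT a u v)) +_) (sumTail-∧-isRoot b (isRoot a u))) (tail-degree a u))
... | inj₂ u = trans (sumJoined a b (λ v → indicator (adjJ a b (inj₂ u) v)))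
  (trans (cong (_+ sumTail b (λ v → indicator (adjT b u v))) (sumTail-isRoot-∧ a (isRoot b u)))
  (trans (+-comm (indicator (isRoot b u)) _) (tail-degree b u)))

reach-trans : {G : Graph n} {u v w : Fin n} → Reach G u v → Reach G v w → Reach G u w
reach-trans here r = r
reach-trans (step a s) r = step a (reach-trans s r)

reach-sym : {G : Graph n} {u v : Fin n} → Reach G u v → Reach G v u
reach-sym here = here
reach-sym {G = G} (step a r) = reach-trans (reach-sym r) (step (Adj-sym G a) here)

end-reach-0 : {G : Graph n} (φ : Embedding (TailAdj []) G) → ∀ u → Reach G (fun φ u) (fun φ 0F)
end-reach-0 φ 0F = here
end-reach-0 φ 1F = step (hom φ refl) here
end-reach-0 φ 2F = step (hom φ refl) here
end-reach-0 φ 3F = step {k = fun φ 1F} (hom φ refl) (step (hom φ refl) here)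
end-reach-0 φ 4F = step {k = fun φ 1F} (hom φ refl) (step (hom φ refl) here)

block-reach-entry : ∀ b l {G : Graph n} (φ : Embedding (TailAdj (b ∷ l)) G) u → Reach G (fun φ (inj₁ u)) (fun φ (inj₁ (entry b)))
block-reach-entry two l φ 0F = here
block-reach-entry two l φ 1F = step (hom φ refl) here
block-reach-entry two l φ 2F = step (hom φ refl) here
block-reach-entry two l φ 3F = step {k = fun φ (inj₁ 1F)} (hom φ refl) (step (hom φ refl) here)
block-reach-entry three l φ 0F = here
block-reach-entry three l φ 1F = step (hom φ refl) here
block-reach-entry three l φ 2F = step (hom φ refl) here
block-reach-entry three l φ 3F = step {k = fun φ (inj₁ 1F)} (hom φ refl) (step (hom φ refl) here)
block-reach-entry three l φ 4F = step {k = fun φ (inj₁ 1F)} (hom φ refl) (step (hom φ refl) here)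
block-reach-entry three l φ 5F = step {k = fun φ (inj₁ 3F)} (hom φ refl) (step {k = fun φ (inj₁ 1F)} (hom φ refl) (step (hom φ refl) here))

reach-root : ∀ l {G : Graph n} (φ : Embedding (TailAdj l) G) u → Reach G (fun φ u) (fun φ (root l))
reach-root [] φ u = end-reach-0 φ u
reach-root (b ∷ l) φ (inj₁ u) = block-reach-entry b l φ u
reach-root (b ∷ l) {G} φ (inj₂ u) = reach-trans (reach-root l (restrict b l φ) u)
  (step (Adj-sym G (hom φ {inj₁ (exit b)} {inj₂ (root l)} (exit-adjacent b l))) (block-reach-entry b l φ (exit b)))

joined-connected : ∀ a b → Connected (joined a b)
joined-connected a b i j = reach-trans (to i) (reach-sym (to j))
  where
  φ = encoding a b
  to′ : ∀ u → Reach (joined a b) (fun φ u) (fun φ (inj₁ (root a)))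
  to′ (inj₁ u) = reach-root a (leftPart a b φ) u
  to′ (inj₂ u) = reach-trans (reach-root b (rightPart a b φ) u) (step (Adj-sym (joined a b) (hom φ {inj₁ (root a)} {inj₂ (root b)} (roots-adjacent a b))) here)
  to : ∀ i → Reach (joined a b) i (fun φ (inj₁ (root a)))
  to i = subst (λ i → Reach (joined a b) i _) (encodeJ-decodeJ a b i) (to′ (decodeJ a b i))

-- Scanning a permutation representation

module _ {V : Set} where

  at : List (Maybe V) → ℕ → Maybe V
  at [] q = nothing
  at (c ∷ s) zero = c
  at (c ∷ s) (suc q) = at s q

  put : List (Maybe V) → ℕ → V → List (Maybe V)
  put [] zero u = just u ∷ []
  put [] (suc p) u = nothing ∷ put [] p u
  put (c ∷ s) zero u = just u ∷ s
  put (c ∷ s) (suc p) u = c ∷ put s p u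

  above : List (Maybe V) → ℕ → List V
  above [] p = []
  above (c ∷ s) zero = catMaybes s
  above (c ∷ s) (suc p) = above s p

  usedIndices : List (Maybe V) → List ℕ
  usedIndices [] = []
  usedIndices (just _ ∷ s) = 0 ∷ map suc (usedIndices s)
  usedIndices (nothing ∷ s) = map suc (usedIndices s)

  inversionIndices : List (Maybe V) → ℕ → List ℕ
  inversionIndices [] zero = []
  inversionIndices [] (suc p) = 0 ∷ map suc (inversionIndices [] p)
  inversionIndices (c ∷ s) zero = map suc (usedIndices s)
  inversionIndices (just _ ∷ s) (suc p) = map suc (inversionIndices s p)
  inversionIndices (nothing ∷ s) (suc p) = 0 ∷ map suc (inversionIndices s p)

  used : List (Maybe V) → ℕ
  used [] = 0
  used (just _ ∷ s) = suc (used s)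
  used (nothing ∷ s) = used s

  -- Defined by recursion and not as a length, so that on a known pattern matching `≡ 3` against
  -- `refl` leaves only the possible offsets.
  inversions : List (Maybe V) → ℕ → ℕ
  inversions [] p = p
  inversions (c ∷ s) zero = used s
  inversions (just _ ∷ s) (suc p) = inversions s p
  inversions (nothing ∷ s) (suc p) = suc (inversions s p)

  length-map-suc : (qs : List ℕ) → length {A = ℕ} (map suc qs) ≡ length qs
  length-map-suc = List.length-map suc

  length-usedIndices : ∀ s → length (usedIndices s) ≡ used s
  length-usedIndices [] = refl
  length-usedIndices (just _ ∷ s) = cong suc (trans (length-map-suc (usedIndices s)) (length-usedIndices s))
  length-usedIndices (nothing ∷ s) = trans (length-map-suc (usedIndices s)) (length-usedIndices s)

  length-inversionIndices : ∀ s p → length (inversionIndices s p) ≡ inversions s p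
  length-inversionIndices [] zero = refl
  length-inversionIndices [] (suc p) = cong suc (trans (length-map-suc (inversionIndices [] p)) (length-inversionIndices [] p))
  length-inversionIndices (c ∷ s) zero = trans (length-map-suc (usedIndices s)) (length-usedIndices s)
  length-inversionIndices (just _ ∷ s) (suc p) = trans (length-map-suc (inversionIndices s p)) (length-inversionIndices s p)
  length-inversionIndices (nothing ∷ s) (suc p) = cong suc (trans (length-map-suc (inversionIndices s p)) (length-inversionIndices s p))

  unique-map-suc : ∀ {qs} → Unique qs → Unique (map suc qs)
  unique-map-suc = Unique.map⁺ suc-injective

  unique-0∷map-suc : ∀ {qs} → Unique qs → Unique (0 ∷ map suc qs)
  unique-0∷map-suc {qs} uqs = All.map⁺ (All.tabulate λ _ ()) ∷ unique-map-suc uqs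

  unique-usedIndices : ∀ s → Unique (usedIndices s)
  unique-usedIndices [] = []
  unique-usedIndices (just _ ∷ s) = unique-0∷map-suc (unique-usedIndices s)
  unique-usedIndices (nothing ∷ s) = unique-map-suc (unique-usedIndices s)

  unique-inversionIndices : ∀ s p → Unique (inversionIndices s p)
  unique-inversionIndices [] zero = []
  unique-inversionIndices [] (suc p) = unique-0∷map-suc (unique-inversionIndices [] p)
  unique-inversionIndices (c ∷ s) zero = unique-map-suc (unique-usedIndices s)
  unique-inversionIndices (just _ ∷ s) (suc p) = unique-map-suc (unique-inversionIndices s p)
  unique-inversionIndices (nothing ∷ s) (suc p) = unique-0∷map-suc (unique-inversionIndices s p)

  ∈-usedIndices⁻ : ∀ s {q} → q ∈ usedIndices s → ∃ λ w → at s q ≡ just w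
  ∈-usedIndices⁻ (just w ∷ s) (here∈ refl) = w , refl
  ∈-usedIndices⁻ (just w ∷ s) (there q∈) with ∈-map⁻ suc q∈
  ... | q , q∈ , refl = ∈-usedIndices⁻ s q∈
  ∈-usedIndices⁻ (nothing ∷ s) q∈ with ∈-map⁻ suc q∈
  ... | q , q∈ , refl = ∈-usedIndices⁻ s q∈

  ∈-usedIndices⁺ : ∀ s q {w} → at s q ≡ just w → q ∈ usedIndices s
  ∈-usedIndices⁺ (just _ ∷ s) zero e = here∈ refl
  ∈-usedIndices⁺ (just _ ∷ s) (suc q) e = there (∈-map⁺ suc (∈-usedIndices⁺ s q e))
  ∈-usedIndices⁺ (nothing ∷ s) (suc q) e = ∈-map⁺ suc (∈-usedIndices⁺ s q e)

  Inverted : List (Maybe V) → ℕ → ℕ → Set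
  Inverted s p q = (q < p × at s q ≡ nothing) ⊎ (p < q × ∃ λ w → at s q ≡ just w)

  Inverted-suc : ∀ c s {p q} → Inverted s p q → Inverted (c ∷ s) (suc p) (suc q)
  Inverted-suc c s (inj₁ (lt , e)) = inj₁ (s≤s lt , e)
  Inverted-suc c s (inj₂ (lt , e)) = inj₂ (s≤s lt , e)

  ∈-inversionIndices⁻ : ∀ s p {q} → q ∈ inversionIndices s p → Inverted s p q
  ∈-inversionIndices⁻ [] (suc p) (here∈ refl) = inj₁ (s≤s z≤n , refl)
  ∈-inversionIndices⁻ [] (suc p) (there q∈) with ∈-map⁻ suc q∈
  ... | q , q∈ , refl with ∈-inversionIndices⁻ [] p q∈
  ... | inj₁ (lt , _) = inj₁ (s≤s lt , refl)
  ∈-inversionIndices⁻ (c ∷ s) zero q∈ with ∈-map⁻ suc q∈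
  ... | q , q∈ , refl = inj₂ (s≤s z≤n , ∈-usedIndices⁻ s q∈)
  ∈-inversionIndices⁻ (just w ∷ s) (suc p) q∈ with ∈-map⁻ suc q∈
  ... | q , q∈ , refl = Inverted-suc (just w) s (∈-inversionIndices⁻ s p q∈)
  ∈-inversionIndices⁻ (nothing ∷ s) (suc p) (here∈ refl) = inj₁ (s≤s z≤n , refl)
  ∈-inversionIndices⁻ (nothing ∷ s) (suc p) (there q∈) with ∈-map⁻ suc q∈
  ... | q , q∈ , refl = Inverted-suc nothing s (∈-inversionIndices⁻ s p q∈)

  ∈-inversionIndices⁺ : ∀ s p q → Inverted s p q → q ∈ inversionIndices s p
  ∈-inversionIndices⁺ [] zero zero (inj₁ (() , _))
  ∈-inversionIndices⁺ [] zero zero (inj₂ (() , _))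
  ∈-inversionIndices⁺ [] (suc p) zero _ = here∈ refl
  ∈-inversionIndices⁺ [] (suc p) (suc q) (inj₁ (s≤s lt , _)) = there (∈-map⁺ suc (∈-inversionIndices⁺ [] p q (inj₁ (lt , refl))))
  ∈-inversionIndices⁺ (c ∷ s) zero (suc q) (inj₂ (_ , w , e)) = ∈-map⁺ suc (∈-usedIndices⁺ s q e)
  ∈-inversionIndices⁺ (just w ∷ s) (suc p) (suc q) (inj₁ (s≤s lt , e)) = ∈-map⁺ suc (∈-inversionIndices⁺ s p q (inj₁ (lt , e)))
  ∈-inversionIndices⁺ (just w ∷ s) (suc p) (suc q) (inj₂ (s≤s lt , e)) = ∈-map⁺ suc (∈-inversionIndices⁺ s p q (inj₂ (lt , e)))
  ∈-inversionIndices⁺ (nothing ∷ s) (suc p) zero _ = here∈ refl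
  ∈-inversionIndices⁺ (nothing ∷ s) (suc p) (suc q) (inj₁ (s≤s lt , e)) = there (∈-map⁺ suc (∈-inversionIndices⁺ s p q (inj₁ (lt , e))))
  ∈-inversionIndices⁺ (nothing ∷ s) (suc p) (suc q) (inj₂ (s≤s lt , e)) = there (∈-map⁺ suc (∈-inversionIndices⁺ s p q (inj₂ (lt , e))))

  at-put : ∀ s p u → at (put s p u) p ≡ just u
  at-put [] zero u = refl
  at-put [] (suc p) u = at-put [] p u
  at-put (c ∷ s) zero u = refl
  at-put (c ∷ s) (suc p) u = at-put s p u

  at-put-≢ : ∀ s p u q → q ≢ p → at (put s p u) q ≡ at s q
  at-put-≢ [] zero u zero q≢ = contradiction refl q≢
  at-put-≢ [] zero u (suc q) q≢ = refl
  at-put-≢ [] (suc p) u zero q≢ = refl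
  at-put-≢ [] (suc p) u (suc q) q≢ = at-put-≢ [] p u q (q≢ ∘ cong suc)
  at-put-≢ (c ∷ s) zero u zero q≢ = contradiction refl q≢
  at-put-≢ (c ∷ s) zero u (suc q) q≢ = refl
  at-put-≢ (c ∷ s) (suc p) u zero q≢ = refl
  at-put-≢ (c ∷ s) (suc p) u (suc q) q≢ = at-put-≢ s p u q (q≢ ∘ cong suc)

  used-put : ∀ s p u → at s p ≡ nothing → used (put s p u) ≡ suc (used s)
  used-put [] zero u e = refl
  used-put [] (suc p) u e = used-put [] p u refl
  used-put (nothing ∷ s) zero u e = refl
  used-put (just _ ∷ s) (suc p) u e = cong suc (used-put s p u e)
  used-put (nothing ∷ s) (suc p) u e = used-put s p u e

  used⇒∃ : ∀ s → 1 ≤ used s → ∃ λ q → ∃ λ w → at s q ≡ just w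
  used⇒∃ (just w ∷ s) _ = 0 , w , refl
  used⇒∃ (nothing ∷ s) lt with used⇒∃ s lt
  ... | q , w , e = suc q , w , e

  ∈-catMaybes⁻ : ∀ s {w} → w ∈ catMaybes s → ∃ λ q → at s q ≡ just w
  ∈-catMaybes⁻ (just w ∷ s) (here∈ refl) = 0 , refl
  ∈-catMaybes⁻ (just w ∷ s) (there w∈) with ∈-catMaybes⁻ s w∈
  ... | q , e = suc q , e
  ∈-catMaybes⁻ (nothing ∷ s) w∈ with ∈-catMaybes⁻ s w∈
  ... | q , e = suc q , e

  ∈-above⁻ : ∀ s p {w} → w ∈ above s p → ∃ λ q → p < q × at s q ≡ just w
  ∈-above⁻ (c ∷ s) zero w∈ with ∈-catMaybes⁻ s w∈
  ... | q , e = suc q , s≤s z≤n , e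
  ∈-above⁻ (c ∷ s) (suc p) w∈ with ∈-above⁻ s p w∈
  ... | q , lt , e = suc q , s≤s lt , e

module Scan {n : ℕ} (G : Graph n) (cubic : ThreeRegular G) (isPerm : IsPermutationGraph G) where

  position : Permutation′ n
  position = proj₁ isPerm

  permuted : Permutation′ n
  permuted = proj₁ (proj₂ isPerm)

  time val : Fin n → ℕ
  time u = toℕ (position ⟨$⟩ˡ u)
  val u = toℕ (permuted ⟨$⟩ʳ (position ⟨$⟩ˡ u))

  time-injective : Injective time
  time-injective e = trans (≡-sym (inverseʳ position)) (trans (cong (position ⟨$⟩ʳ_) (Fin.toℕ-injective e)) (inverseʳ position))

  val-injective : Injective val
  val-injective e = time-injective (cong toℕ (trans (≡-sym (inverseˡ permuted)) (trans (cong (permuted ⟨$⟩ˡ_) (Fin.toℕ-injective e)) (inverseˡ permuted))))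

  time<n : ∀ u → time u < n
  time<n u = Fin.toℕ<n _

  val<n : ∀ u → val u < n
  val<n u = Fin.toℕ<n _

  atTime : ∀ {i} → i < n → ∃ λ u → time u ≡ i
  atTime lt = position ⟨$⟩ʳ fromℕ< lt , trans (cong toℕ (inverseˡ position)) (Fin.toℕ-fromℕ< lt)

  atVal : ∀ {i} → i < n → ∃ λ u → val u ≡ i
  atVal lt = position ⟨$⟩ʳ (permuted ⟨$⟩ˡ fromℕ< lt) ,
    trans (cong (λ i → toℕ (permuted ⟨$⟩ʳ i)) (inverseˡ position)) (trans (cong toℕ (inverseʳ permuted)) (Fin.toℕ-fromℕ< lt))

  module _ {u w : Fin n} (lt : time u < time w) where
    private
      equiv = proj₂ (proj₂ isPerm) (position ⟨$⟩ˡ u) (position ⟨$⟩ˡ w) lt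

    adj⇒val> : Adj G u w → val w < val u
    adj⇒val> a = Equivalence.to equiv (subst₂ (Adj G) (≡-sym (inverseʳ position)) (≡-sym (inverseʳ position)) a)

    val>⇒adj : val w < val u → Adj G u w
    val>⇒adj lt = subst₂ (Adj G) (inverseʳ position) (inverseʳ position) (Equivalence.from equiv lt)

  Cell : ℕ → Maybe (Fin n) → Fin n → Set
  Cell i nothing u = i ≤ time u
  Cell i (just w) u = w ≡ u × time u < i

  -- Before time i exactly the values below k and the values k + q with a
  -- vertex in cell q of s have been used.
  record State (i k : ℕ) (s : List (Maybe (Fin n))) : Set where
    field
      low : ∀ u → val u < k → time u < i
      cell : ∀ q u → val u ≡ k + q → Cell i (at s q) u
      occupied : ∀ q w → at s q ≡ just w → val w ≡ k + q
  open State

  cell-just : ∀ {i k s} → State i k s → ∀ q u {w} → val u ≡ k + q → at s q ≡ just w → time u < i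
  cell-just st q u e e′ with cell st q u e
  ... | c rewrite e′ = proj₂ c

  cell-nothing : ∀ {i k s} → State i k s → ∀ q u → val u ≡ k + q → at s q ≡ nothing → i ≤ time u
  cell-nothing st q u e e′ with cell st q u e
  ... | c rewrite e′ = c

  late⇒free : ∀ {i k s} → State i k s → ∀ q u → val u ≡ k + q → i ≤ time u → at s q ≡ nothing
  late⇒free {s = s} st q u e le with at s q in e′
  ... | nothing = refl
  ... | just w = contradiction (cell-just st q u e e′) (≤⇒≯ le)

  early⇒used : ∀ {i k s} → State i k s → ∀ q u → val u ≡ k + q → time u < i → ∃ λ w → at s q ≡ just w
  early⇒used {s = s} st q u e lt with at s q in e′
  ... | just w = w , refl
  ... | nothing = contradiction (cell-nothing st q u e e′) (<⇒≱ lt)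

  late⇒offset : ∀ {i k s} → State i k s → ∀ u → i ≤ time u → ∃ λ q → val u ≡ k + q
  late⇒offset {k = k} st u le with k ≤? val u
  ... | yes k≤ = val u ∸ k , ≡-sym (m+[n∸m]≡n k≤)
  ... | no k≰ = contradiction (low st u (≰⇒> k≰)) (≤⇒≯ le)

  pop : ∀ {i k w s} → State i k (just w ∷ s) → State i (suc k) s
  low (pop {k = k} st) u (s≤s lt) with m≤n⇒m<n∨m≡n lt
  ... | inj₁ lt′ = low st u lt′
  ... | inj₂ e = cell-just st 0 u (trans e (≡-sym (+-identityʳ k))) refl
  cell (pop {k = k} st) q u e = cell st (suc q) u (trans e (≡-sym (+-suc k q)))
  occupied (pop {k = k} st) q w e = trans (occupied st (suc q) w e) (+-suc k q)

  module _ {i k p : ℕ} {s : List (Maybe (Fin n))} (st : State i k s) {u : Fin n} (time-u : time u ≡ i) (val-u : val u ≡ k + p) where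

    free : at s p ≡ nothing
    free = late⇒free st p u val-u (≤-reflexive (≡-sym time-u))

    below-adjacent : ∀ {q w} → q < p → val w ≡ k + q → at s q ≡ nothing → Adj G u w
    below-adjacent {q} {w} q<p e e′ = val>⇒adj u<w (subst₂ _<_ (≡-sym e) (≡-sym val-u) (+-monoʳ-< k q<p))
      where
      u<w : time u < time w
      u<w = ≤∧≢⇒< (subst (_≤ time w) (≡-sym time-u) (cell-nothing st q w e e′))
        (λ t → <-irrefl (+-cancelˡ-≡ k q p (trans (≡-sym e) (trans (cong val (≡-sym (time-injective t))) val-u))) q<p)

    above-adjacent : ∀ {q w} → p < q → at s q ≡ just w → Adj G u w
    above-adjacent {q} {w} p<q e = Adj-sym G (val>⇒adj (subst (time w <_) (≡-sym time-u) (cell-just st q w val-w e))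
      (subst₂ _<_ (≡-sym val-u) (≡-sym val-w) (+-monoʳ-< k p<q)))
      where
      val-w = occupied st q w e

    -- An earlier neighbour has a larger value, in a used cell above `p`. A later one has a smaller
    -- value, which is still at least `k` because all values below `k` are used.
    neighbour⇒inverted : ∀ w → Adj G u w → ∃ λ q → val w ≡ k + q × Inverted s p q
    neighbour⇒inverted w a with <-cmp (time w) (time u)
    ... | tri≈ _ e _ = contradiction (≡-sym (time-injective e)) (Adj⇒≢ G a)
    ... | tri< lt _ _ = q , val-w , inj₂ (+-cancelˡ-< k p q (subst₂ _<_ val-u val-w vlt) , early⇒used st q w val-w (subst (time w <_) time-u lt))
      where
      vlt = adj⇒val> lt (Adj-sym G a)
      q = val w ∸ k
      val-w : val w ≡ k + q
      val-w = ≡-sym (m+[n∸m]≡n (≤-trans (m≤m+n k p) (≤-trans (≤-reflexive (≡-sym val-u)) (<⇒≤ vlt))))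
    ... | tri> _ _ gt with late⇒offset st w (<⇒≤ (subst (_< time w) time-u gt))
    ...   | q , val-w = q , val-w , inj₁ (+-cancelˡ-< k q p (subst₂ _<_ val-w val-u (adj⇒val> gt a)) , late⇒free st q w val-w (<⇒≤ (subst (_< time w) time-u gt)))

    inverted⇒neighbour : ∀ q → Inverted s p q → ∃ λ w → Adj G u w × val w ≡ k + q
    inverted⇒neighbour q (inj₁ (q<p , e)) with atVal (<-trans (+-monoʳ-< k q<p) (subst (_< n) val-u (val<n u)))
    ... | w , val-w = w , below-adjacent q<p val-w e , val-w
    inverted⇒neighbour q (inj₂ (p<q , w , e)) = w , above-adjacent p<q e , occupied st q w e

    -- The inverted offsets, translated by `k`, are exactly the values of the neighbours of `u`;
    -- both lists are without repetition, so they have equal length.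
    three-inversions : inversions s p ≡ 3
    three-inversions = begin
      inversions s p                                ≡⟨ length-inversionIndices s p ⟨
      length (inversionIndices s p)                 ≡⟨ List.length-map (k +_) (inversionIndices s p) ⟨
      length (map (k +_) (inversionIndices s p))    ≡⟨ ≤-antisym
        (unique⊆⇒length≤ (Unique.map⁺ (+-cancelˡ-≡ k _ _) (unique-inversionIndices s p)) sub₁)
        (unique⊆⇒length≤ (Unique.map⁺ val-injective (unique-neighbours G u)) sub₂) ⟩
      length (map val (neighbours G u))             ≡⟨ List.length-map val (neighbours G u) ⟩
      length (neighbours G u)                       ≡⟨ length-neighbours G u ⟩
      degree G u                                    ≡⟨ cubic u ⟩
      3                                             ∎
      where
      open ≡-Reasoning
      sub₁ : ∀ {x} → x ∈ map (k +_) (inversionIndices s p) → x ∈ map val (neighbours G u)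
      sub₁ x∈ with ∈-map⁻ (k +_) x∈
      ... | q , q∈ , refl with inverted⇒neighbour q (∈-inversionIndices⁻ s p q∈)
      ... | w , a , val-w = subst (_∈ _) val-w (∈-map⁺ val (∈-neighbours⁺ G a))
      sub₂ : ∀ {x} → x ∈ map val (neighbours G u) → x ∈ map (k +_) (inversionIndices s p)
      sub₂ x∈ with ∈-map⁻ val x∈
      ... | w , w∈ , refl with neighbour⇒inverted w (∈-neighbours⁻ G w∈)
      ... | q , val-w , inv = subst (_∈ _) (≡-sym val-w) (∈-map⁺ (k +_) (∈-inversionIndices⁺ s p q inv))

    next-state : State (suc i) k (put s p u)
    low next-state w lt = m≤n⇒m≤1+n (low st w lt)
    cell next-state q w e with q ≟ p
    ... | yes refl rewrite at-put s p u = val-injective (trans val-u (≡-sym e)) ,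
      s≤s (≤-reflexive (trans (cong time (val-injective (trans e (≡-sym val-u)))) time-u))
    ... | no q≢p rewrite at-put-≢ s p u q q≢p with at s q in eq
    ...   | nothing = ≤∧≢⇒< (cell-nothing st q w e eq) (λ t → q≢p (+-cancelˡ-≡ k q p (trans (≡-sym e) (trans (cong val (time-injective (trans (≡-sym t) (≡-sym time-u)))) val-u))))
    ...   | just x = val-injective (trans (occupied st q x eq) (≡-sym e)) , m≤n⇒m≤1+n (cell-just st q w e eq)
    occupied next-state q w e with q ≟ p
    ... | yes refl rewrite at-put s p u with e
    ...   | refl = val-u
    occupied next-state q w e | no q≢p rewrite at-put-≢ s p u q q≢p = occupied st q w e

  -- A used value above `k` shows that `k` is itself the value of some vertex, and that vertex is
  -- still to come.
  free-bottom : ∀ {i k s} → State i k (nothing ∷ s) → 1 ≤ used s → ∃ λ z → val z ≡ k × i ≤ time z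
  free-bottom {k = k} {s} st lt with used⇒∃ s lt
  ... | q , w , e with atVal {k} (≤-<-trans (≤-trans (m≤m+n k (suc q)) (≤-reflexive (≡-sym (occupied st (suc q) w e)))) (val<n w))
  ...   | z , val-z = z , val-z , cell-nothing st 0 z (trans val-z (≡-sym (+-identityʳ k))) refl

  -- All used values above the free value k are inverted with it.
  used≤3 : ∀ {i k s} → State i k (nothing ∷ s) → 1 ≤ used s → used s ≤ 3
  used≤3 {k = k} {s} st lt with free-bottom st lt
  ... | z , val-z , late = subst₂ _≤_
    (trans (List.length-map (λ q → k + suc q) (usedIndices s)) (length-usedIndices s))
    (trans (List.length-map val (neighbours G z)) (trans (length-neighbours G z) (cubic z)))
    (unique⊆⇒length≤ {xs = map (λ q → k + suc q) (usedIndices s)} {map val (neighbours G z)}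
      (Unique.map⁺ (λ e → suc-injective (+-cancelˡ-≡ k _ _ e)) (unique-usedIndices s)) sub)
    where
    sub : ∀ {x} → x ∈ map (λ q → k + suc q) (usedIndices s) → x ∈ map val (neighbours G z)
    sub x∈ with ∈-map⁻ (λ q → k + suc q) x∈
    ... | q , q∈ , refl with ∈-usedIndices⁻ s q∈
    ... | w , e = subst (_∈ _) val-w (∈-map⁺ val (∈-neighbours⁺ G (Adj-sym G
        (val>⇒adj (<-≤-trans (cell-just st (suc q) w val-w e) late) (subst₂ _<_ (≡-sym val-z) (≡-sym val-w) (m<m+n k (s≤s z≤n)))))))
      where
      val-w = occupied st (suc q) w e

  -- The field `few-used` looks one step ahead: if the bottom cell stays free, the next state has
  -- one more used value and is again subject to the bound three.
  record Step (i k : ℕ) (s : List (Maybe (Fin n))) : Set where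
    constructor mkStep
    field
      offset : ℕ
      vertex : Fin n
      time-vertex : time vertex ≡ i
      is-free : at s offset ≡ nothing
      three-inv : inversions s offset ≡ 3
      few-used : offset ≡ 0 ⊎ used s ≤ 2
      next : State (suc i) k (put s offset vertex)
      adjacent : All (Adj G vertex) (above s offset)

  all-above : ∀ {i k p s u} → State i k s → time u ≡ i → val u ≡ k + p → All (Adj G u) (above s p)
  all-above {p = p} {s} st time-u val-u = All.tabulate λ w∈ →
    let (q , p<q , e) = ∈-above⁻ s p w∈ in above-adjacent st time-u val-u p<q e

  abstract
    -- The scan cannot be over: the vertex with value `k` has time at least `i`, so some vertex has
    -- time exactly `i`.
    step-from : ∀ {i k s} → State i k (nothing ∷ s) → 1 ≤ used s → Step i k (nothing ∷ s)
    step-from {i} {k} {s} st lt with free-bottom st lt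
    ... | z , _ , late with atTime (≤-<-trans late (time<n z))
    ... | u , time-u with late⇒offset st u (≤-reflexive (≡-sym time-u))
    ... | p , val-u = mkStep p u time-u fr (three-inversions st time-u val-u) (few p fr (next-state st time-u val-u)) (next-state st time-u val-u) (all-above st time-u val-u)
      where
      fr : at (nothing ∷ s) p ≡ nothing
      fr = free st time-u val-u
      few : ∀ p → at (nothing ∷ s) p ≡ nothing → State (suc i) k (put (nothing ∷ s) p u) → p ≡ 0 ⊎ used s ≤ 2
      few zero _ _ = inj₁ refl
      few (suc p) fr nx = inj₂ (≤-pred (subst (_≤ 3) (used-put s p u fr) (used≤3 nx (subst (1 ≤_) (≡-sym (used-put s p u fr)) (s≤s z≤n)))))

  initial : State 0 0 []
  low initial u ()
  cell initial q u e = z≤n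
  occupied initial q w ()

  abstract
    first-step : 1 ≤ n → Step 0 0 []
    first-step lt with atTime lt
    ... | u , time-u with late⇒offset initial u z≤n
    ... | p , val-u = mkStep p u time-u refl (three-inversions initial time-u val-u) (inj₂ z≤n) (next-state initial time-u val-u) []

-- Forced patterns of the scan and the classification.

tableGraph : {s : ℕ} (es : List (Fin s × Fin s)) → (∀ u → table es u u ≡ false) → Graph s
adj (tableGraph es ir) = table es
sym (tableGraph es ir) = table-sym es
irrefl (tableGraph es ir) = ir

edges-K₄ : List (Fin 4 × Fin 4)
edges-K₄ = (0F , 1F) ∷ (0F , 2F) ∷ (0F , 3F) ∷ (1F , 2F) ∷ (1F , 3F) ∷ (2F , 3F) ∷ []

edges-K₃₃ : List (Fin 6 × Fin 6)
edges-K₃₃ = (0F , 3F) ∷ (0F , 4F) ∷ (0F , 5F) ∷ (1F , 3F) ∷ (1F , 4F) ∷ (1F , 5F) ∷ (2F , 3F) ∷ (2F , 4F) ∷ (2F , 5F) ∷ []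

K₄ : Graph 4
K₄ = tableGraph edges-K₄ (from-yes (Fin.all? λ u → table edges-K₄ u u Bool.≟ false))

K₃₃ : Graph 6
K₃₃ = tableGraph edges-K₃₃ (from-yes (Fin.all? λ u → table edges-K₃₃ u u Bool.≟ false))

Distinct : {s : ℕ} → Vec ℕ s → Set
Distinct o = ∀ x y → lookup o x ≡ lookup o y → x ≡ y

distinct? : {s : ℕ} (o : Vec ℕ s) → Dec (Distinct o)
distinct? o = Fin.all? λ x → Fin.all? λ y → (lookup o x ≟ lookup o y) →-dec (x Fin.≟ y)

distinct : {s : ℕ} (o : Vec ℕ s) → From-yes (distinct? o)
distinct o = from-yes (distinct? o)

-- The times of a tail whose root is scanned at `j`, before the near end of its bridge: time `j + 1`
-- belongs to that near end.
Interleaved : ℕ → ℕ → Set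
Interleaved j t = t ≡ j ⊎ 2 + j ≤ t

mkInterleaved : ∀ {o j} → o ≡ 0 ⊎ 2 ≤ o → Interleaved j (o + j)
mkInterleaved (inj₁ refl) = inj₁ refl
mkInterleaved (inj₂ le) = inj₂ (+-monoˡ-≤ _ le)

¬Interleaved : ∀ {o d i} → o ≢ d × o < 2 + d → ¬ Interleaved (d + i) (o + i)
¬Interleaved (o≢d , _) (inj₁ e) = o≢d (+-cancelʳ-≡ _ _ _ e)
¬Interleaved {o} {d} {i} (_ , lt) (inj₂ le) = <⇒≱ (+-monoˡ-< i lt) le

Interleaved⇒≤ : ∀ {d i t} → Interleaved (d + i) t → i ≤ t
Interleaved⇒≤ {d} {i} (inj₁ refl) = m≤n+m i d
Interleaved⇒≤ {d} {i} (inj₂ le) = ≤-trans (m≤n+m i (2 + d)) le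

module Classify {n : ℕ} (G : Graph n) (cubic : ThreeRegular G) (isPerm : IsPermutationGraph G) where
  open Scan G cubic isPerm

  abstract
    -- With three used values above the free value `k`, `few-used` rules out every offset but 0, and
    -- the new vertex is inverted with all three.
    bottom-step : ∀ {i k s} → State i k (nothing ∷ s) → used s ≡ 3 →
      ∃ λ u → time u ≡ i × All (Adj G u) (catMaybes s) × State (suc i) (suc k) s
    bottom-step {s = s} st u3 with step-from st (subst (1 ≤_) (≡-sym u3) (s≤s z≤n))
    ... | mkStep 0 u t _ _ _ nx as = u , t , as , pop nx
    ... | mkStep (suc p) _ _ _ _ (inj₂ le) _ _ = contradiction (subst (_≤ 2) u3 le) λ { (s≤s (s≤s ())) }

  record Crossing (i : ℕ) (a b : Fin n) : Set where
    constructor crossing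
    field
      {base} : ℕ
      c d : Fin n
      time-c : time c ≡ i
      time-d : time d ≡ suc i
      da : Adj G d a
      db : Adj G d b
      dc : Adj G d c
      state : State (2 + i) base (nothing ∷ nothing ∷ just c ∷ [])

  -- Both `a` and `b` lack only the neighbour with value `k`. Offset 5 is the only one with three
  -- inversions; it puts `c` above them, and then `d` takes `k` and meets `a`, `b` and `c`. Thus `d`
  -- closes the current block and `c` is the far end of the next bridge.
  cross : ∀ {i k a b} → State i k (nothing ∷ just a ∷ just b ∷ []) → Crossing i a b
  cross st with step-from st (s≤s z≤n)
  ... | mkStep 5 c tc _ refl _ st₁ [] with bottom-step st₁ refl
  ...   | d , td , da ∷ db ∷ dc ∷ [] , st₂ = crossing c d tc td da db dc (pop (pop st₂))

  -- Here `a` and `b` lack the same two neighbours, those with the two smallest free values. These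
  -- two are adjacent in `finish`; in `onward` they have a third common neighbour `x`, from which
  -- the next bridge leaves.
  data Fork (i : ℕ) (a b : Fin n) : Set where
    finish : ∀ g h → time g ≡ i → time h ≡ suc i →
      Adj G g a → Adj G g b → Adj G h g → Adj G h a → Adj G h b → Fork i a b
    onward : ∀ {k} x y z → time x ≡ i → time y ≡ suc i → time z ≡ 2 + i →
      Adj G y a → Adj G y b → Adj G y x → Adj G z a → Adj G z b → Adj G z x →
      State (3 + i) k (nothing ∷ just x ∷ []) → Fork i a b

  fork : ∀ {i k a b} → State i k (nothing ∷ nothing ∷ just a ∷ just b ∷ []) → Fork i a b
  fork st with step-from st (s≤s z≤n)
  ... | mkStep 1 g tg _ refl _ st₁ (ga ∷ gb ∷ []) with bottom-step st₁ refl
  ...   | h , th , hg ∷ ha ∷ hb ∷ [] , _ = finish g h tg th ga gb hg ha hb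
  fork st | mkStep 5 x tx _ refl _ st₁ [] with bottom-step st₁ refl
  ...   | y , ty , ya ∷ yb ∷ yx ∷ [] , st₂ with bottom-step st₂ refl
  ...     | z , tz , za ∷ zb ∷ zx ∷ [] , st₃ = onward x y z tx ty tz ya yb yx za zb zx (pop (pop st₃))

  -- The predicate `Q` bounds the times that occur, so that a piece added later is disjoint from the
  -- tail as soon as its own times violate `Q`.
  record TailIn (Q : ℕ → Set) : Set where
    constructor tailIn
    field
      word : List Block
      emb : Embedding (TailAdj word) G
      times : ∀ v → Q (time (fun emb v))
  open TailIn

  Timed : {s : ℕ} → ℕ → Vec (Fin n) s → Vec ℕ s → Set
  Timed i f o = ∀ u → time (lookup f u) ≡ lookup o u + i

  timed-injective : ∀ {s i} {f : Vec (Fin n) s} {o : Vec ℕ s} → Timed i f o → Distinct o → Injective (lookup f)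
  timed-injective tf distinct {x} {y} e = distinct x y (+-cancelʳ-≡ _ _ _ (trans (≡-sym (tf x)) (trans (cong time e) (tf y))))

  timed-embedding : ∀ {s i} (es : List (Fin s × Fin s)) (f : Vec (Fin n) s) (o : Vec ℕ s) → Timed i f o → Distinct o →
    EdgesIn G (lookup f) es → Embedding (λ u v → table es u v ≡ true) G
  timed-embedding es f o tf distinct as =
    record { fun = lookup f; injective = timed-injective {f = f} {o} tf distinct; hom = table-hom G (lookup f) as }

  singleton-tail : ∀ {i Q} (f : Vec (Fin n) 5) (o : Vec ℕ 5) → Timed i f o → Distinct o →
    EdgesIn G (lookup f) endEdges → (∀ u → Q (lookup o u + i)) → TailIn Q
  singleton-tail {Q = Q} f o tf distinct es q = tailIn []
    (timed-embedding endEdges f o tf distinct es)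
    (λ v → subst Q (≡-sym (tf v)) (q v))

  extend : ∀ b {i Q Q′} (f : Vec (Fin n) (order b)) (o : Vec ℕ (order b)) → Timed i f o → Distinct o →
    EdgesIn G (lookup f) (edges b) → (T : TailIn Q′) → Adj G (lookup f (exit b)) (fun (emb T) (root (word T))) →
    (∀ u → ¬ Q′ (lookup o u + i)) → (∀ u → Q (lookup o u + i)) → (∀ {t} → Q′ t → Q t) → TailIn Q
  extend b {Q = Q} {Q′} f o tf distinct es (tailIn l φ ts) a fresh q Q′⇒Q = tailIn (b ∷ l) ψ ts′
    where
    g : Tail (b ∷ l) → Fin n
    g (inj₁ u) = lookup f u
    g (inj₂ v) = fun φ v
    apart : ∀ {u v} → lookup f u ≢ fun φ v
    apart {u} {v} e = fresh u (subst Q′ (trans (cong time (≡-sym e)) (tf u)) (ts v))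
    bridge : ∀ {u v} → isExit b u ∧ isRoot l v ≡ true → Adj G (lookup f u) (fun φ v)
    bridge {u} {v} p with u Fin.≟ exit b
    ... | yes refl with isRoot⇒≡ l p
    ...   | refl = a
    ψ : Embedding (TailAdj (b ∷ l)) G
    fun ψ = g
    injective ψ {inj₁ u} {inj₁ v} e = cong inj₁ (timed-injective {f = f} {o} tf distinct e)
    injective ψ {inj₁ u} {inj₂ v} e = contradiction e apart
    injective ψ {inj₂ u} {inj₁ v} e = contradiction (≡-sym e) apart
    injective ψ {inj₂ u} {inj₂ v} e = cong inj₂ (injective φ e)
    hom ψ {inj₁ u} {inj₁ v} p = table-hom G (lookup f) es p
    hom ψ {inj₁ u} {inj₂ v} p = bridge p
    hom ψ {inj₂ u} {inj₁ v} p = Adj-sym G (bridge p)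
    hom ψ {inj₂ u} {inj₂ v} p = hom φ p
    ts′ : ∀ v → Q (time (g v))
    ts′ (inj₁ u) = subst Q (≡-sym (tf u)) (q u)
    ts′ (inj₂ v) = Q′⇒Q (ts v)

  -- The fuel `m` bounds the number of vertices still to be scanned; each recursive call spends one
  -- unit while the time advances by `suc d`.
  more-fuel : ∀ {m i} d → n ≤ suc m + i → n ≤ m + (suc d + i)
  more-fuel {m} {i} d le = ≤-trans le (≤-trans (≤-reflexive (≡-sym (+-suc m i))) (+-monoʳ-≤ m (s≤s (m≤n+m i d))))

  mutual

    -- The next bridge leaves x, and its other end has not been scanned yet.
    scan-single : ∀ m {i k x} → n ≤ m + i → State i k (nothing ∷ just x ∷ []) →
      Σ (TailIn (i ≤_)) λ T → Adj G x (fun (emb T) (root (word T)))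
    scan-single m {i} le st with step-from st (s≤s z≤n)
    scan-single zero {i} le st | mkStep _ u tu _ _ _ _ _ = contradiction (subst (n ≤_) (≡-sym tu) le) (<⇒≱ (time<n u))
    scan-single (suc m) {i} le st | mkStep 4 c tc _ refl _ st₁ [] with step-from st₁ (s≤s z≤n)
    -- Here `e` is adjacent to `c`, giving the triangle of a block `two`; the next bridge is crossed
    -- far end first.
    ... | mkStep 3 e te _ refl _ st₂ (ec ∷ []) with bottom-step st₂ refl
    ...   | f , tf , fx ∷ fe ∷ fc ∷ [] , st₃ with cross (pop st₃)
    ...     | crossing c′ d tc′ td de dc dc′ st₄ with scan-double m (more-fuel 2 le) tc′ st₄
    ...       | T , r = extend two (f ∷ e ∷ c ∷ d ∷ []) (2 ∷ 1 ∷ 0 ∷ 4 ∷ [])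
      (λ { 0F → tf ; 1F → te ; 2F → tc ; 3F → td }) (distinct (2 ∷ 1 ∷ 0 ∷ 4 ∷ []))
      (fe ∷ fc ∷ ec ∷ Adj-sym G de ∷ Adj-sym G dc ∷ []) T (subst (Adj G d) (≡-sym r) dc′)
      -- Of the times `i` to `4 + i`, only `3 + i` is not taken by the block: it is the time of
      -- `c′`, the root of the next tail.
      (λ u → ¬Interleaved (from-yes (Fin.all? λ u → let o = lookup (2 ∷ 1 ∷ 0 ∷ 4 ∷ []) u in ¬? (o ≟ 3) ×-dec (o <? 5)) u))
      (λ u → m≤n+m i _) (Interleaved⇒≤ {d = 3}) , Adj-sym G fx
    -- Here `c` and `e` are not adjacent and `f` is joined to both, which leaves the end piece or a
    -- block `three`.
    scan-single (suc m) {i} le st | mkStep 4 c tc _ refl _ st₁ [] | mkStep 5 e te _ refl _ st₂ [] with bottom-step st₂ refl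
    ...   | f , tf , fx ∷ fc ∷ fe ∷ [] , st₃ with fork (pop st₃)
    ...     | finish g h tg th gc ge hg hc he = singleton-tail (f ∷ c ∷ e ∷ g ∷ h ∷ []) (2 ∷ 0 ∷ 1 ∷ 3 ∷ 4 ∷ [])
      (λ { 0F → tf ; 1F → tc ; 2F → te ; 3F → tg ; 4F → th }) (distinct (2 ∷ 0 ∷ 1 ∷ 3 ∷ 4 ∷ []))
      (fc ∷ fe ∷ Adj-sym G gc ∷ Adj-sym G hc ∷ Adj-sym G ge ∷ Adj-sym G he ∷ Adj-sym G hg ∷ [])
      (λ u → m≤n+m i _) , Adj-sym G fx
    ...     | onward x′ y z tx ty tz yc ye yx zc ze zx st₄ with scan-single m (more-fuel 5 le) st₄
    ...       | T , r = extend three (f ∷ c ∷ e ∷ y ∷ z ∷ x′ ∷ []) (2 ∷ 0 ∷ 1 ∷ 4 ∷ 5 ∷ 3 ∷ [])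
      (λ { 0F → tf ; 1F → tc ; 2F → te ; 3F → ty ; 4F → tz ; 5F → tx }) (distinct (2 ∷ 0 ∷ 1 ∷ 4 ∷ 5 ∷ 3 ∷ []))
      (fc ∷ fe ∷ Adj-sym G yc ∷ Adj-sym G zc ∷ Adj-sym G ye ∷ Adj-sym G ze ∷ yx ∷ zx ∷ []) T r
      (λ u → <⇒≱ (+-monoˡ-< i (from-yes (Fin.all? λ u → lookup (2 ∷ 0 ∷ 1 ∷ 4 ∷ 5 ∷ 3 ∷ []) u <? 6) u)))
      (λ u → m≤n+m i _) (≤-trans (m≤n+m i 6)) , Adj-sym G fx

    -- The far end c of the last bridge was scanned just before its near end.
    scan-double : ∀ m {j k c} → n ≤ m + j → time c ≡ j → State (2 + j) k (nothing ∷ nothing ∷ just c ∷ []) →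
      Σ (TailIn (Interleaved j)) λ T → fun (emb T) (root (word T)) ≡ c
    scan-double zero {c = c} le tc st = contradiction (subst (n ≤_) (≡-sym tc) le) (<⇒≱ (time<n c))
    scan-double (suc m) {j} {c = c} le tc st with step-from st (s≤s z≤n)
    ... | mkStep 4 e te _ refl _ st₁ [] with step-from st₁ (s≤s z≤n)
    -- Here `y` is adjacent to both `c` and `e`. This is a block `two` with entry `c` and exit `e`,
    -- after which the pattern of `scan-single` returns.
    ...   | mkStep 1 y ty _ refl _ st₂ (yc ∷ ye ∷ []) with bottom-step st₂ refl
    ...     | z , tz , zy ∷ zc ∷ ze ∷ [] , st₃ with scan-single m (more-fuel 4 le) (pop (pop st₃))
    ...       | T , r = extend two (c ∷ y ∷ z ∷ e ∷ []) (0 ∷ 3 ∷ 4 ∷ 2 ∷ [])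
      (λ { 0F → tc ; 1F → ty ; 2F → tz ; 3F → te }) (distinct (0 ∷ 3 ∷ 4 ∷ 2 ∷ []))
      (Adj-sym G yc ∷ Adj-sym G zc ∷ Adj-sym G zy ∷ ye ∷ ze ∷ []) T r
      (λ u → <⇒≱ (+-monoˡ-< j (from-yes (Fin.all? λ u → lookup (0 ∷ 3 ∷ 4 ∷ 2 ∷ []) u <? 5) u)))
      (λ u → mkInterleaved (from-yes (Fin.all? λ u → let o = lookup (0 ∷ 3 ∷ 4 ∷ 2 ∷ []) u in (o ≟ 0) ⊎-dec (2 ≤? o)) u))
      (λ le → inj₂ (≤-trans (m≤n+m (2 + j) 3) le)) , refl
    -- An edge from `y` to `e` alone: two more vertices complete the end piece with root `c`.
    scan-double (suc m) {j} {c = c} le tc st | mkStep 4 e te _ refl _ st₁ [] | mkStep 3 y ty _ refl _ st₂ (ye ∷ []) with bottom-step st₂ refl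
    ...     | u , tu , uc ∷ uy ∷ ue ∷ [] , st₃ with bottom-step st₃ refl
    ...       | v , tv , vc ∷ vy ∷ ve ∷ [] , _ = singleton-tail (c ∷ u ∷ v ∷ y ∷ e ∷ []) (0 ∷ 4 ∷ 5 ∷ 3 ∷ 2 ∷ [])
      (λ { 0F → tc ; 1F → tu ; 2F → tv ; 3F → ty ; 4F → te }) (distinct (0 ∷ 4 ∷ 5 ∷ 3 ∷ 2 ∷ []))
      (Adj-sym G uc ∷ Adj-sym G vc ∷ uy ∷ ue ∷ vy ∷ ve ∷ ye ∷ [])
      (λ u → mkInterleaved (from-yes (Fin.all? λ u → let o = lookup (0 ∷ 4 ∷ 5 ∷ 3 ∷ 2 ∷ []) u in (o ≟ 0) ⊎-dec (2 ≤? o)) u)) , refl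
    -- Here `x` has no earlier neighbour: `u` and `v` are joined to `c`, `e` and `x`, and crossing
    -- to the next bridge completes a block `three`.
    scan-double (suc m) {j} {c = c} le tc st | mkStep 4 e te _ refl _ st₁ [] | mkStep 5 x tx _ refl _ st₂ [] with bottom-step st₂ refl
    ...     | u , tu , uc ∷ ue ∷ ux ∷ [] , st₃ with bottom-step st₃ refl
    ...       | v , tv , vc ∷ ve ∷ vx ∷ [] , st₄ with cross (pop st₄)
    ...         | crossing c′ d tc′ td de dx dc′ st₅ with scan-double m (more-fuel 5 le) tc′ st₅
    ...           | T , r = extend three (c ∷ u ∷ v ∷ e ∷ x ∷ d ∷ []) (0 ∷ 4 ∷ 5 ∷ 2 ∷ 3 ∷ 7 ∷ [])
      (λ { 0F → tc ; 1F → tu ; 2F → tv ; 3F → te ; 4F → tx ; 5F → td }) (distinct (0 ∷ 4 ∷ 5 ∷ 2 ∷ 3 ∷ 7 ∷ []))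
      (Adj-sym G uc ∷ Adj-sym G vc ∷ ue ∷ ux ∷ ve ∷ vx ∷ Adj-sym G de ∷ Adj-sym G dx ∷ []) T (subst (Adj G d) (≡-sym r) dc′)
      (λ u → ¬Interleaved (from-yes (Fin.all? λ u → let o = lookup (0 ∷ 4 ∷ 5 ∷ 2 ∷ 3 ∷ 7 ∷ []) u in ¬? (o ≟ 6) ×-dec (o <? 8)) u))
      (λ u → mkInterleaved (from-yes (Fin.all? λ u → let o = lookup (0 ∷ 4 ∷ 5 ∷ 2 ∷ 3 ∷ 7 ∷ []) u in (o ≟ 0) ⊎-dec (2 ≤? o)) u))
      (λ q → inj₂ (≤-trans (m≤n+m (2 + j) 4) (Interleaved⇒≤ {d = 0} q))) , refl

  joined-embedding : ∀ {Q} (f : Vec (Fin n) 5) (o : Vec ℕ 5) → Timed 0 f o → Distinct o →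
    EdgesIn G (lookup f) endEdges → (T : TailIn Q) → Adj G (lookup f 0F) (fun (emb T) (root (word T))) →
    (∀ u → ¬ Q (lookup o u)) → Embedding (JoinedAdj [] (word T)) G
  joined-embedding {Q} f o tf distinct es (tailIn l φ ts) a fresh = ψ
    where
    g : Joined [] l → Fin n
    g (inj₁ u) = lookup f u
    g (inj₂ v) = fun φ v
    apart : ∀ {u v} → lookup f u ≢ fun φ v
    apart {u} {v} e = fresh u (subst Q (trans (cong time (≡-sym e)) (trans (tf u) (+-identityʳ _))) (ts v))
    bridge : ∀ {u v} → isRoot [] u ∧ isRoot l v ≡ true → Adj G (lookup f u) (fun φ v)
    bridge {u} {v} p with u Fin.≟ 0F
    ... | yes refl with isRoot⇒≡ l p
    ...   | refl = a
    ψ : Embedding (JoinedAdj [] l) G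
    fun ψ = g
    injective ψ {inj₁ u} {inj₁ v} e = cong inj₁ (timed-injective {f = f} {o} tf distinct e)
    injective ψ {inj₁ u} {inj₂ v} e = contradiction e apart
    injective ψ {inj₂ u} {inj₁ v} e = contradiction (≡-sym e) apart
    injective ψ {inj₂ u} {inj₂ v} e = cong inj₂ (injective φ e)
    hom ψ {inj₁ u} {inj₁ v} p = table-hom G (lookup f) es p
    hom ψ {inj₁ u} {inj₂ v} p = bridge p
    hom ψ {inj₂ u} {inj₁ v} p = Adj-sym G (bridge p)
    hom ψ {inj₂ u} {inj₂ v} p = hom φ p

  data Found : Set where
    found-K₄ : Embedding (Adj K₄) G → Found
    found-K₃₃ : Embedding (Adj K₃₃) G → Found
    found-chain : ∀ l → Embedding (JoinedAdj [] l) G → Found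

  classify : 1 ≤ n → Found
  classify lt with first-step lt
  -- While nothing is used, the offset is itself the number of inversions.
  ... | mkStep 3 a ta _ refl _ st₁ [] with step-from st₁ (s≤s z≤n)
  -- If the first two vertices are adjacent, the fork yields K₄ or a left end followed by a bridge
  -- scanned near end first.
  ...   | mkStep 2 b tb _ refl _ st₂ (ba ∷ []) with fork st₂
  ...     | finish g h tg th gb ga hg hb ha = found-K₄ (timed-embedding {i = 0} edges-K₄ (a ∷ b ∷ g ∷ h ∷ []) (0 ∷ 1 ∷ 2 ∷ 3 ∷ [])
      (λ { 0F → ta ; 1F → tb ; 2F → tg ; 3F → th }) (distinct (0 ∷ 1 ∷ 2 ∷ 3 ∷ []))
      (Adj-sym G ba ∷ Adj-sym G ga ∷ Adj-sym G ha ∷ Adj-sym G gb ∷ Adj-sym G hb ∷ Adj-sym G hg ∷ []))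
  ...     | onward x y z tx ty tz yb ya yx zb za zx st₃ with scan-single n (m≤m+n n _) st₃
  ...       | T , r = found-chain (word T) (joined-embedding (x ∷ y ∷ z ∷ a ∷ b ∷ []) (2 ∷ 3 ∷ 4 ∷ 0 ∷ 1 ∷ [])
      (λ { 0F → tx ; 1F → ty ; 2F → tz ; 3F → ta ; 4F → tb }) (distinct (2 ∷ 3 ∷ 4 ∷ 0 ∷ 1 ∷ []))
      (Adj-sym G yx ∷ Adj-sym G zx ∷ ya ∷ yb ∷ za ∷ zb ∷ Adj-sym G ba ∷ []) T r
      (λ u → <⇒≱ (from-yes (Fin.all? λ u → lookup (2 ∷ 3 ∷ 4 ∷ 0 ∷ 1 ∷ []) u <? 5) u)))
  classify lt | mkStep 3 a ta _ refl _ st₁ [] | mkStep 4 c tc _ refl _ st₂ [] with step-from st₂ (s≤s z≤n)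
  ...     | mkStep 1 y ty _ refl _ st₃ (ya ∷ yc ∷ []) with bottom-step st₃ refl
  ...       | z , tz , zy ∷ za ∷ zc ∷ [] , st₄ with cross (pop st₄)
  ...         | crossing c′ d tc′ td da dc dc′ st₅ with scan-double n (m≤m+n n _) tc′ st₅
  ...           | T , r = found-chain (word T) (joined-embedding (d ∷ a ∷ c ∷ y ∷ z ∷ []) (5 ∷ 0 ∷ 1 ∷ 2 ∷ 3 ∷ [])
      (λ { 0F → td ; 1F → ta ; 2F → tc ; 3F → ty ; 4F → tz }) (distinct (5 ∷ 0 ∷ 1 ∷ 2 ∷ 3 ∷ []))
      (da ∷ dc ∷ Adj-sym G ya ∷ Adj-sym G za ∷ Adj-sym G yc ∷ Adj-sym G zc ∷ Adj-sym G zy ∷ []) T (subst (Adj G d) (≡-sym r) dc′)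
      -- The tail starts with `c′` at time 4; time 5 is that of `d`, the root of the left end.
      (from-yes (Fin.all? λ u → let o = lookup (5 ∷ 0 ∷ 1 ∷ 2 ∷ 3 ∷ []) u in ¬? ((o ≟ 4) ⊎-dec (6 ≤? o)))))
  classify lt | mkStep 3 a ta _ refl _ st₁ [] | mkStep 4 c tc _ refl _ st₂ [] | mkStep 5 e te _ refl _ st₃ [] with bottom-step st₃ refl
  ...       | u , tu , ua ∷ uc ∷ ue ∷ [] , st₄ with bottom-step st₄ refl
  ...         | v , tv , va ∷ vc ∷ ve ∷ [] , st₅ with bottom-step st₅ refl
  ...           | w , tw , wa ∷ wc ∷ we ∷ [] , st₆ = found-K₃₃ (timed-embedding {i = 0} edges-K₃₃ (a ∷ c ∷ e ∷ u ∷ v ∷ w ∷ []) (0 ∷ 1 ∷ 2 ∷ 3 ∷ 4 ∷ 5 ∷ [])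
      (λ { 0F → ta ; 1F → tc ; 2F → te ; 3F → tu ; 4F → tv ; 5F → tw }) (distinct (0 ∷ 1 ∷ 2 ∷ 3 ∷ 4 ∷ 5 ∷ []))
      (Adj-sym G ua ∷ Adj-sym G va ∷ Adj-sym G wa ∷ Adj-sym G uc ∷ Adj-sym G vc ∷ Adj-sym G wc ∷ Adj-sym G ue ∷ Adj-sym G ve ∷ Adj-sym G we ∷ []))

-- Permutation representations from pairs of coordinates

-- Replaces distinct keys, possibly with gaps, by positions in `Fin n` in the same order.
module Rank {n : ℕ} (key : Fin n → ℕ) (key-injective : Injective key) where

  smaller : Fin n → List (Fin n)
  smaller u = filter (λ w → key w <? key u) (allFin n)

  ∈-smaller⁺ : ∀ {u w} → key w < key u → w ∈ smaller u
  ∈-smaller⁺ {u} {w} lt = ∈-filter⁺ (λ w → key w <? key u) (∈-allFin w) lt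

  ∈-smaller⁻ : ∀ {u w} → w ∈ smaller u → key w < key u
  ∈-smaller⁻ {u} w∈ = proj₂ (∈-filter⁻ (λ w → key w <? key u) {xs = allFin n} w∈)

  unique-∷smaller : ∀ u → Unique (u ∷ smaller u)
  unique-∷smaller u = All.tabulate (λ w∈ e → <-irrefl (cong key (≡-sym e)) (∈-smaller⁻ w∈))
    ∷ Unique.filter⁺ (λ w → key w <? key u) (Unique.allFin⁺ n)

  smaller<n : ∀ u → length (smaller u) < n
  smaller<n u = subst (suc (length (smaller u)) ≤_) (List.length-tabulate id)
    (unique⊆⇒length≤ {ys = allFin n} (unique-∷smaller u) (λ _ → ∈-allFin _))

  rank : Fin n → Fin n
  rank u = fromℕ< (smaller<n u)

  toℕ-rank : ∀ u → toℕ (rank u) ≡ length (smaller u)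
  toℕ-rank u = Fin.toℕ-fromℕ< (smaller<n u)

  rank-mono : ∀ {u w} → key u < key w → toℕ (rank u) < toℕ (rank w)
  rank-mono {u} {w} lt = subst₂ _<_ (≡-sym (toℕ-rank u)) (≡-sym (toℕ-rank w)) (unique⊆⇒length≤ (unique-∷smaller u) sub)
    where
    sub : ∀ {x} → x ∈ u ∷ smaller u → x ∈ smaller w
    sub (here∈ refl) = ∈-smaller⁺ lt
    sub (there x∈) = ∈-smaller⁺ (<-trans (∈-smaller⁻ x∈) lt)

  rank-reflects : ∀ {u w} → toℕ (rank u) < toℕ (rank w) → key u < key w
  rank-reflects {u} {w} lt with <-cmp (key u) (key w)
  ... | tri< lt′ _ _ = lt′
  ... | tri≈ _ e _ = contradiction lt (<-irrefl (cong (toℕ ∘ rank) (key-injective e)))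
  ... | tri> _ _ gt = contradiction (rank-mono gt) (<-asym lt)

  rank-injective : Injective rank
  rank-injective {u} {w} e with <-cmp (key u) (key w)
  ... | tri< lt _ _ = contradiction (rank-mono lt) (<-irrefl (cong toℕ e))
  ... | tri≈ _ e′ _ = key-injective e′
  ... | tri> _ _ gt = contradiction (rank-mono gt) (<-irrefl (cong toℕ (≡-sym e)))

  rank-permutation : Permutation′ n
  rank-permutation = permutation rank (proj₁ ∘ surj) (proj₂ ∘ surj) (λ u → rank-injective (proj₂ (surj (rank u))))
    where surj = injective⇒surjective rank rank-injective

-- Points of the plane represent a permutation graph, edges being the pairs ordered oppositely by
-- the two coordinates. The condition is invariant under exchanging the coordinates and under
-- translation along the diagonal.
Consistent : Bool → ℕ × ℕ → ℕ × ℕ → Set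
Consistent true (a , b) (c , d) = (a < c × d < b) ⊎ (c < a × b < d)
Consistent false (a , b) (c , d) = (a < c × b < d) ⊎ (c < a × d < b)

consistent? : ∀ e κ κ′ → Dec (Consistent e κ κ′)
consistent? true (a , b) (c , d) = ((a <? c) ×-dec (d <? b)) ⊎-dec ((c <? a) ×-dec (b <? d))
consistent? false (a , b) (c , d) = ((a <? c) ×-dec (b <? d)) ⊎-dec ((c <? a) ×-dec (d <? b))

consistent-sym : ∀ e {κ κ′} → Consistent e κ κ′ → Consistent e κ′ κ
consistent-sym true (inj₁ p) = inj₂ p
consistent-sym true (inj₂ p) = inj₁ p
consistent-sym false (inj₁ p) = inj₂ p
consistent-sym false (inj₂ p) = inj₁ p

consistent-swap : ∀ e {κ κ′} → Consistent e κ κ′ → Consistent e (swap κ) (swap κ′)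
consistent-swap true (inj₁ (p , q)) = inj₂ (q , p)
consistent-swap true (inj₂ (p , q)) = inj₁ (q , p)
consistent-swap false (inj₁ (p , q)) = inj₁ (q , p)
consistent-swap false (inj₂ (p , q)) = inj₂ (q , p)

shift : ℕ → ℕ × ℕ → ℕ × ℕ
shift s (a , b) = s + a , s + b

consistent-shift : ∀ s e {κ κ′} → Consistent e κ κ′ → Consistent e (shift s κ) (shift s κ′)
consistent-shift s true (inj₁ (p , q)) = inj₁ (+-monoʳ-< s p , +-monoʳ-< s q)
consistent-shift s true (inj₂ (p , q)) = inj₂ (+-monoʳ-< s p , +-monoʳ-< s q)
consistent-shift s false (inj₁ (p , q)) = inj₁ (+-monoʳ-< s p , +-monoʳ-< s q)
consistent-shift s false (inj₂ (p , q)) = inj₂ (+-monoʳ-< s p , +-monoʳ-< s q)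

consistent⇒≢ : ∀ e {a b c d} → Consistent e (a , b) (c , d) → a ≢ c
consistent⇒≢ true (inj₁ (p , _)) refl = <-irrefl refl p
consistent⇒≢ true (inj₂ (p , _)) refl = <-irrefl refl p
consistent⇒≢ false (inj₁ (p , _)) refl = <-irrefl refl p
consistent⇒≢ false (inj₂ (p , _)) refl = <-irrefl refl p

consistent⇒> : ∀ {a b c d} → Consistent true (a , b) (c , d) → a < c → d < b
consistent⇒> (inj₁ (_ , q)) _ = q
consistent⇒> (inj₂ (p , _)) lt = contradiction lt (<-asym p)

>⇒consistent : ∀ e {a b c d} → Consistent e (a , b) (c , d) → a < c → d < b → e ≡ true
>⇒consistent true _ _ _ = refl
>⇒consistent false (inj₁ (_ , q)) _ gt = contradiction gt (<-asym q)
>⇒consistent false (inj₂ (p , _)) lt _ = contradiction lt (<-asym p)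

-- Label the vertices in the order of the first coordinate and let the permutation record the rank
-- of the second. Strictness in `Consistent` makes both coordinates injective.
permutation-graph : (G : Graph n) (κ : Fin n → ℕ × ℕ) →
  (∀ u w → u ≡ w ⊎ Consistent (adj G u w) (κ u) (κ w)) → IsPermutationGraph G
permutation-graph {n} G κ con = flip R₁.rank-permutation , flip R₁.rank-permutation ∘ₚ R₂.rank-permutation , main
  where
  inj₁-κ : Injective (proj₁ ∘ κ)
  inj₁-κ {u} {w} e with con u w
  ... | inj₁ p = p
  ... | inj₂ c = contradiction e (consistent⇒≢ (adj G u w) c)
  inj₂-κ : Injective (proj₂ ∘ κ)
  inj₂-κ {u} {w} e with con u w
  ... | inj₁ p = p
  ... | inj₂ c = contradiction e (consistent⇒≢ (adj G u w) (consistent-swap (adj G u w) c))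
  module R₁ = Rank (proj₁ ∘ κ) inj₁-κ
  module R₂ = Rank (proj₂ ∘ κ) inj₂-κ
  v : Fin n → Fin n
  v i = R₁.rank-permutation ⟨$⟩ˡ i
  main : ∀ i j → toℕ i < toℕ j → Adj G (v i) (v j) ⇔ toℕ (R₂.rank (v j)) < toℕ (R₂.rank (v i))
  main i j lt with con (v i) (v j)
  ... | inj₁ e = contradiction lt (<-irrefl (cong toℕ (trans (≡-sym (inverseʳ R₁.rank-permutation)) (trans (cong R₁.rank e) (inverseʳ R₁.rank-permutation)))))
  ... | inj₂ c = mk⇔
      (λ a → R₂.rank-mono (consistent⇒> (subst (λ e → Consistent e (κ (v i)) (κ (v j))) a c) earlier))
      (λ gt → >⇒consistent (adj G (v i) (v j)) c earlier (R₂.rank-reflects gt))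
    where
    earlier : proj₁ (κ (v i)) < proj₁ (κ (v j))
    earlier = R₁.rank-reflects (subst₂ _<_ (cong toℕ (≡-sym (inverseʳ R₁.rank-permutation))) (cong toℕ (≡-sym (inverseʳ R₁.rank-permutation))) lt)

-- The keys are the (position , value) pairs met along the scan.
endKeys : Vec (ℕ × ℕ) 5
endKeys = (3 , 0) ∷ (1 , 4) ∷ (2 , 5) ∷ (4 , 3) ∷ (5 , 2) ∷ []

blockKeys : (b : Block) → Vec (ℕ × ℕ) (order b)
blockKeys two = (3 , 0) ∷ (2 , 3) ∷ (1 , 4) ∷ (6 , 2) ∷ []
blockKeys three = (3 , 0) ∷ (1 , 4) ∷ (2 , 5) ∷ (5 , 2) ∷ (6 , 3) ∷ (4 , 8) ∷ []

leftKeys : Vec (ℕ × ℕ) 5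
leftKeys = (2 , 6) ∷ (3 , 0) ∷ (4 , 1) ∷ (0 , 3) ∷ (1 , 2) ∷ []

-- After a block of order 4 the next bridge is an interleaving of the other
-- coordinate.
place : Block → ℕ × ℕ → ℕ × ℕ
place two κ = shift 5 (swap κ)
place three κ = shift 7 κ

tailKey : ∀ l → Tail l → ℕ × ℕ
tailKey [] u = lookup endKeys u
tailKey (b ∷ l) (inj₁ u) = lookup (blockKeys b) u
tailKey (b ∷ l) (inj₂ v) = place b (tailKey l v)

-- The vertex to which the root is attached has second coordinate 1 and
-- a first coordinate below all others.
Placed : Bool → ℕ × ℕ → Set
Placed true (a , b) = 1 ≤ a × b ≡ 0
Placed false (a , b) = 1 ≤ a × 2 ≤ b

placed? : ∀ e κ → Dec (Placed e κ)
placed? true (a , b) = (1 ≤? a) ×-dec (b ≟ 0)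
placed? false (a , b) = (1 ≤? a) ×-dec (2 ≤? b)

tailKey-placed : ∀ l v → Placed (isRoot l v) (tailKey l v)
tailKey-placed [] = from-yes (Fin.all? λ u → placed? (isRoot [] u) (lookup endKeys u))
tailKey-placed (two ∷ l) (inj₁ u) = from-yes (Fin.all? λ u → placed? (isEntry two u) (lookup (blockKeys two) u)) u
tailKey-placed (three ∷ l) (inj₁ u) = from-yes (Fin.all? λ u → placed? (isEntry three u) (lookup (blockKeys three) u)) u
tailKey-placed (two ∷ l) (inj₂ v) = s≤s z≤n , s≤s (s≤s z≤n)
tailKey-placed (three ∷ l) (inj₂ v) = s≤s z≤n , s≤s (s≤s z≤n)

lower-left : ∀ s {x y} κ → x < s → y < s → Consistent false (x , y) (shift s κ)
lower-left s (a , b) x< y< = inj₁ (<-≤-trans x< (m≤m+n s a) , <-≤-trans y< (m≤m+n s b))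

-- The exit of an unswapped block sits at (x , s + 1).
attached : ∀ s {x} e κ → x < s → Placed e κ → Consistent e (x , s + 1) (shift s κ)
attached s true (a , b) x< (_ , refl) = inj₁ (<-≤-trans x< (m≤m+n s a) , +-monoʳ-< s (s≤s z≤n))
attached s false (a , b) x< (_ , le) = inj₁ (<-≤-trans x< (m≤m+n s a) , +-monoʳ-< s le)

decide< : ∀ x s → From-yes (x <? s)
decide< x s = from-yes (x <? s)

-- The shifts 5 and 7 exceed every coordinate in the block except one of the exit, so the other
-- vertices lie below and to the left of the tail. That one coordinate is the shift plus 1, which
-- passes the root of the tail and nothing else.
block-consistent : ∀ b u e κ → Placed e κ → Consistent (isExit b u ∧ e) (lookup (blockKeys b) u) (place b κ)
block-consistent two 0F e κ p = lower-left 5 (swap κ) (decide< 3 5) (decide< 0 5)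
block-consistent two 1F e κ p = lower-left 5 (swap κ) (decide< 2 5) (decide< 3 5)
block-consistent two 2F e κ p = lower-left 5 (swap κ) (decide< 1 5) (decide< 4 5)
block-consistent two 3F e κ p = consistent-swap e (attached 5 e κ (decide< 2 5) p)
block-consistent three 0F e κ p = lower-left 7 κ (decide< 3 7) (decide< 0 7)
block-consistent three 1F e κ p = lower-left 7 κ (decide< 1 7) (decide< 4 7)
block-consistent three 2F e κ p = lower-left 7 κ (decide< 2 7) (decide< 5 7)
block-consistent three 3F e κ p = lower-left 7 κ (decide< 5 7) (decide< 2 7)
block-consistent three 4F e κ p = lower-left 7 κ (decide< 6 7) (decide< 3 7)
block-consistent three 5F e κ p = attached 7 e κ (decide< 4 7) p

left-consistent : ∀ u e κ → Placed e κ → Consistent (isRoot [] u ∧ e) (lookup leftKeys u) (shift 5 κ)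
left-consistent 0F e κ p = attached 5 e κ (decide< 2 5) p
left-consistent 1F e κ p = lower-left 5 κ (decide< 3 5) (decide< 0 5)
left-consistent 2F e κ p = lower-left 5 κ (decide< 4 5) (decide< 1 5)
left-consistent 3F e κ p = lower-left 5 κ (decide< 0 5) (decide< 3 5)
left-consistent 4F e κ p = lower-left 5 κ (decide< 1 5) (decide< 2 5)

TableConsistent : {s : ℕ} → List (Fin s × Fin s) → Vec (ℕ × ℕ) s → Set
TableConsistent es κ = ∀ u w → u ≡ w ⊎ Consistent (table es u w) (lookup κ u) (lookup κ w)

tableConsistent? : {s : ℕ} (es : List (Fin s × Fin s)) (κ : Vec (ℕ × ℕ) s) → Dec (TableConsistent es κ)
tableConsistent? es κ = Fin.all? λ u → Fin.all? λ w → (u Fin.≟ w) ⊎-dec consistent? (table es u w) (lookup κ u) (lookup κ w)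

place-consistent : ∀ b e {κ κ′} → Consistent e κ κ′ → Consistent e (place b κ) (place b κ′)
place-consistent two e c = consistent-shift 5 e (consistent-swap e c)
place-consistent three e c = consistent-shift 7 e c

tail-consistent : ∀ l u w → u ≡ w ⊎ Consistent (adjT l u w) (tailKey l u) (tailKey l w)
tail-consistent [] u w = from-yes (tableConsistent? endEdges endKeys) u w
tail-consistent (two ∷ l) (inj₁ u) (inj₁ w) = Data.Sum.map₁ (cong inj₁) (from-yes (tableConsistent? (edges two) (blockKeys two)) u w)
tail-consistent (three ∷ l) (inj₁ u) (inj₁ w) = Data.Sum.map₁ (cong inj₁) (from-yes (tableConsistent? (edges three) (blockKeys three)) u w)
tail-consistent (b ∷ l) (inj₁ u) (inj₂ w) = inj₂ (block-consistent b u (isRoot l w) (tailKey l w) (tailKey-placed l w))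
tail-consistent (b ∷ l) (inj₂ u) (inj₁ w) = inj₂ (consistent-sym (isExit b w ∧ isRoot l u) (block-consistent b w (isRoot l u) (tailKey l u) (tailKey-placed l u)))
tail-consistent (b ∷ l) (inj₂ u) (inj₂ w) = Data.Sum.map (cong inj₂) (place-consistent b (adjT l u w)) (tail-consistent l u w)

chainKey : ∀ l → Joined [] l → ℕ × ℕ
chainKey l (inj₁ u) = lookup leftKeys u
chainKey l (inj₂ v) = shift 5 (tailKey l v)

chain-consistent : ∀ l u w → u ≡ w ⊎ Consistent (adjJ [] l u w) (chainKey l u) (chainKey l w)
chain-consistent l (inj₁ u) (inj₁ w) = Data.Sum.map₁ (cong inj₁) (from-yes (tableConsistent? endEdges leftKeys) u w)
chain-consistent l (inj₁ u) (inj₂ w) = inj₂ (left-consistent u (isRoot l w) (tailKey l w) (tailKey-placed l w))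
chain-consistent l (inj₂ u) (inj₁ w) = inj₂ (consistent-sym (isRoot [] w ∧ isRoot l u) (left-consistent w (isRoot l u) (tailKey l u) (tailKey-placed l u)))
chain-consistent l (inj₂ u) (inj₂ w) = Data.Sum.map (cong inj₂) (consistent-shift 5 (adjT l u w)) (tail-consistent l u w)

chain : ∀ l → Graph (5 + tailSize l)
chain l = joined [] l

chain-cubicConnPerm : ∀ l → CubicConnPerm (chain l)
chain-cubicConnPerm l = joined-connected [] l , joined-cubic [] l ,
  permutation-graph (chain l) (chainKey l ∘ decodeJ [] l) λ u w →
    Data.Sum.map₁ (λ e → trans (≡-sym (encodeJ-decodeJ [] l u)) (trans (cong (encodeJ [] l) e) (encodeJ-decodeJ [] l w)))
      (chain-consistent l (decodeJ [] l u) (decodeJ [] l w))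

keys-K₄ : Vec (ℕ × ℕ) 4
keys-K₄ = (0 , 3) ∷ (1 , 2) ∷ (2 , 1) ∷ (3 , 0) ∷ []

keys-K₃₃ : Vec (ℕ × ℕ) 6
keys-K₃₃ = (0 , 3) ∷ (1 , 4) ∷ (2 , 5) ∷ (3 , 0) ∷ (4 , 1) ∷ (5 , 2) ∷ []

cubic-K₄ : ThreeRegular K₄
cubic-K₄ = from-yes (Fin.all? λ u → degree K₄ u ≟ 3)

cubic-K₃₃ : ThreeRegular K₃₃
cubic-K₃₃ = from-yes (Fin.all? λ u → degree K₃₃ u ≟ 3)

reach-0⇒connected : {G : Graph (suc n)} → (∀ u → Reach G u zero) → Connected G
reach-0⇒connected r u w = reach-trans (r u) (reach-sym (r w))

cubicConnPerm-K₄ : CubicConnPerm K₄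
cubicConnPerm-K₄ = reach-0⇒connected
    (λ { 0F → here ; 1F → step refl here ; 2F → step refl here ; 3F → step refl here }) , cubic-K₄ ,
  permutation-graph K₄ (lookup keys-K₄) (from-yes (tableConsistent? edges-K₄ keys-K₄))

cubicConnPerm-K₃₃ : CubicConnPerm K₃₃
cubicConnPerm-K₃₃ = reach-0⇒connected
    (λ { 0F → here ; 1F → step {k = 3F} refl (step refl here) ; 2F → step {k = 3F} refl (step refl here)
       ; 3F → step refl here ; 4F → step refl here ; 5F → step refl here }) , cubic-K₃₃ ,
  permutation-graph K₃₃ (lookup keys-K₃₃) (from-yes (tableConsistent? edges-K₃₃ keys-K₃₃))

-- Reversing a chain

-- The symmetry of a block that exchanges entry and exit: it makes a block look the same from either
-- end of the chain.
mirror : (b : Block) → Fin (order b) → Fin (order b)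
mirror two = lookup (3F ∷ 1F ∷ 2F ∷ 0F ∷ [])
mirror three = lookup (5F ∷ 3F ∷ 4F ∷ 1F ∷ 2F ∷ 0F ∷ [])

mirror-involutive : ∀ b u → mirror b (mirror b u) ≡ u
mirror-involutive two = from-yes (Fin.all? λ u → mirror two (mirror two u) Fin.≟ u)
mirror-involutive three = from-yes (Fin.all? λ u → mirror three (mirror three u) Fin.≟ u)

mirror-edges : ∀ b u v → table (edges b) (mirror b u) (mirror b v) ≡ table (edges b) u v
mirror-edges two = from-yes (Fin.all? λ u → Fin.all? λ v → table (edges two) (mirror two u) (mirror two v) Bool.≟ table (edges two) u v)
mirror-edges three = from-yes (Fin.all? λ u → Fin.all? λ v → table (edges three) (mirror three u) (mirror three v) Bool.≟ table (edges three) u v)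

mirror-entry : ∀ b u → isEntry b (mirror b u) ≡ isExit b u
mirror-entry two = from-yes (Fin.all? λ u → isEntry two (mirror two u) Bool.≟ isExit two u)
mirror-entry three = from-yes (Fin.all? λ u → isEntry three (mirror three u) Bool.≟ isExit three u)

mirror-exit : ∀ b u → isExit b (mirror b u) ≡ isEntry b u
mirror-exit b u = trans (≡-sym (mirror-entry b (mirror b u))) (cong (isEntry b) (mirror-involutive b u))

-- The graph stays the same; the chosen bridge jumps over the block `b`, whose entry and exit change
-- roles.
move : ∀ b l l′ → Joined (b ∷ l) l′ → Joined l (b ∷ l′)
move b l l′ (inj₁ (inj₁ u)) = inj₂ (inj₁ (mirror b u))
move b l l′ (inj₁ (inj₂ u)) = inj₁ u
move b l l′ (inj₂ u) = inj₂ (inj₂ u)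

move-injective : ∀ b l l′ → Injective (move b l l′)
move-injective b l l′ {u} {v} e = trans (≡-sym (back-move u)) (trans (cong back e) (back-move v))
  where
  back : Joined l (b ∷ l′) → Joined (b ∷ l) l′
  back (inj₁ u) = inj₁ (inj₂ u)
  back (inj₂ (inj₁ u)) = inj₁ (inj₁ (mirror b u))
  back (inj₂ (inj₂ u)) = inj₂ u
  back-move : ∀ u → back (move b l l′ u) ≡ u
  back-move (inj₁ (inj₁ u)) = cong (inj₁ ∘ inj₁) (mirror-involutive b u)
  back-move (inj₁ (inj₂ u)) = refl
  back-move (inj₂ u) = refl

move-adj : ∀ b l l′ u v → adjJ l (b ∷ l′) (move b l l′ u) (move b l l′ v) ≡ adjJ (b ∷ l) l′ u v
move-adj b l l′ (inj₁ (inj₁ u)) (inj₁ (inj₁ v)) = mirror-edges b u v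
move-adj b l l′ (inj₁ (inj₁ u)) (inj₁ (inj₂ v)) = trans (cong (isRoot l v ∧_) (mirror-entry b u)) (Bool.∧-comm (isRoot l v) _)
move-adj b l l′ (inj₁ (inj₁ u)) (inj₂ v) = cong (_∧ isRoot l′ v) (mirror-exit b u)
move-adj b l l′ (inj₁ (inj₂ u)) (inj₁ (inj₁ v)) = trans (cong (isRoot l u ∧_) (mirror-entry b v)) (Bool.∧-comm (isRoot l u) _)
move-adj b l l′ (inj₁ (inj₂ u)) (inj₁ (inj₂ v)) = refl
move-adj b l l′ (inj₁ (inj₂ u)) (inj₂ v) = Bool.∧-zeroʳ (isRoot l u)
move-adj b l l′ (inj₂ u) (inj₁ (inj₁ v)) = cong (_∧ isRoot l′ u) (mirror-exit b v)
move-adj b l l′ (inj₂ u) (inj₁ (inj₂ v)) = Bool.∧-zeroʳ (isRoot l v)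
move-adj b l l′ (inj₂ u) (inj₂ v) = refl

along-move : ∀ b l l′ {G : Graph n} → Embedding (JoinedAdj l (b ∷ l′)) G → Embedding (JoinedAdj (b ∷ l) l′) G
fun (along-move b l l′ φ) = fun φ ∘ move b l l′
injective (along-move b l l′ φ) = move-injective b l l′ ∘ injective φ
hom (along-move b l l′ φ) {u} {v} p = hom φ (trans (move-adj b l l′ u v) p)

swapped : ∀ l l′ {G : Graph n} → Embedding (JoinedAdj l l′) G → Embedding (JoinedAdj l′ l) G
fun (swapped l l′ φ) = fun φ ∘ Data.Sum.swap
injective (swapped l l′ φ) {inj₁ u} {inj₁ v} e with injective φ e
... | refl = refl
injective (swapped l l′ φ) {inj₁ u} {inj₂ v} e with injective φ e
... | ()
injective (swapped l l′ φ) {inj₂ u} {inj₁ v} e with injective φ e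
... | ()
injective (swapped l l′ φ) {inj₂ u} {inj₂ v} e with injective φ e
... | refl = refl
hom (swapped l l′ φ) {inj₁ u} {inj₁ v} p = hom φ p
hom (swapped l l′ φ) {inj₁ u} {inj₂ v} p = hom φ (trans (Bool.∧-comm (isRoot l v) (isRoot l′ u)) p)
hom (swapped l l′ φ) {inj₂ u} {inj₁ v} p = hom φ (trans (Bool.∧-comm (isRoot l u) (isRoot l′ v)) p)
hom (swapped l l′ φ) {inj₂ u} {inj₂ v} p = hom φ p

gather : ∀ l a {G : Graph n} → Embedding (JoinedAdj a l) G → Embedding (JoinedAdj (l ʳ++ a) []) G
gather [] a φ = φ
gather (b ∷ l) a φ = gather l (b ∷ a) (along-move b a l φ)

endOf : ∀ l → Fin 5 → Tail l
endOf [] u = u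
endOf (b ∷ l) u = inj₂ (endOf l u)

-- The right end piece is never touched while the blocks travel left. `chain-words` needs this to
-- know where the reversed chain starts.
gather-end : ∀ l a {G : Graph n} (φ : Embedding (JoinedAdj a l) G) u → fun (gather l a φ) (inj₂ u) ≡ fun φ (inj₂ (endOf l u))
gather-end [] a φ u = refl
gather-end (b ∷ l) a φ u = gather-end l (b ∷ a) (along-move b a l φ) u

reversed : ∀ l {G : Graph n} → Embedding (JoinedAdj [] l) G → Embedding (JoinedAdj [] (reverse l)) G
reversed l φ = swapped (reverse l) [] (gather l [] φ)

-- Reading the word off a chain

-- Equality of unordered pairs: the two inner vertices next to an entry are interchangeable, so a
-- reading determines them only up to order.
data SamePair {A : Set} (a b c d : A) : Set where
  straight : a ≡ c → b ≡ d → SamePair a b c d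
  crossed : a ≡ d → b ≡ c → SamePair a b c d

pair-both : {A : Set} {a b c d : A} (P : A → Set) → SamePair a b c d → P c → P d → P a × P b
pair-both P (straight refl refl) pc pd = pc , pd
pair-both P (crossed refl refl) pc pd = pd , pc

module Reading {n : ℕ} (G : Graph n) (cubic : ThreeRegular G) where

  record Nbhd (v a b c : Fin n) : Set where
    constructor nb
    field
      va : Adj G v a
      vb : Adj G v b
      vc : Adj G v c
      a≢b : a ≢ b
      a≢c : a ≢ c
      b≢c : b ≢ c

  only : ∀ {v a b c d} → Nbhd v a b c → Adj G v d → d ≡ a ⊎ d ≡ b ⊎ d ≡ c
  only (nb va vb vc a≢b a≢c b≢c) = neighbours-only G cubic va vb vc a≢b a≢c b≢c

  non-adjacent : ∀ {v a b c d} → Nbhd v a b c → d ≢ a → d ≢ b → d ≢ c → ¬ Adj G v d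
  non-adjacent N d≢a d≢b d≢c vd with only N vd
  ... | inj₁ e = d≢a e
  ... | inj₂ (inj₁ e) = d≢b e
  ... | inj₂ (inj₂ e) = d≢c e

  third : ∀ {v a b c d} → Nbhd v a b c → Adj G v d → d ≢ a → d ≢ b → d ≡ c
  third N vd d≢a d≢b with only N vd
  ... | inj₁ e = contradiction e d≢a
  ... | inj₂ (inj₁ e) = contradiction e d≢b
  ... | inj₂ (inj₂ e) = e

  other-pair : ∀ {v a b c d e} → Nbhd v a b c → Nbhd v a d e → SamePair b c d e
  other-pair N (nb _ vd ve a≢d a≢e d≢e) with only N vd | only N ve
  ... | inj₁ p | _ = contradiction (≡-sym p) a≢d
  ... | inj₂ _ | inj₁ q = contradiction (≡-sym q) a≢e
  ... | inj₂ (inj₁ p) | inj₂ (inj₁ q) = contradiction (trans p (≡-sym q)) d≢e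
  ... | inj₂ (inj₁ p) | inj₂ (inj₂ q) = straight (≡-sym p) (≡-sym q)
  ... | inj₂ (inj₂ p) | inj₂ (inj₁ q) = crossed (≡-sym q) (≡-sym p)
  ... | inj₂ (inj₂ p) | inj₂ (inj₂ q) = contradiction (trans p (≡-sym q)) d≢e

  module _ {V : Set} {_∼_ : V → V → Set} (φ : Embedding _∼_ G) where

    apart : ∀ {u v} → u ≢ v → fun φ u ≢ fun φ v
    apart u≢v e = u≢v (injective φ e)

    nbhd : ∀ {u} a b c → u ∼ a → u ∼ b → u ∼ c → a ≢ b → a ≢ c → b ≢ c → Nbhd (fun φ u) (fun φ a) (fun φ b) (fun φ c)
    nbhd a b c ua ub uc a≢b a≢c b≢c = nb (hom φ ua) (hom φ ub) (hom φ uc) (apart a≢b) (apart a≢c) (apart b≢c)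

    root-nbhd : ∀ {r x} a b → Adj G x (fun φ r) → r ∼ a → r ∼ b → a ≢ b → (∀ v → x ≢ fun φ v) → Nbhd (fun φ r) x (fun φ a) (fun φ b)
    root-nbhd a b xr ra rb a≢b out = nb (Adj-sym G xr) (hom φ ra) (hom φ rb) (out a) (out b) (apart a≢b)

  -- The starting point of a reading: `x` lies outside the tail and singles out the bridge among the
  -- three edges at `r`.
  record Rooted (l : List Block) (x r : Fin n) : Set where
    constructor rooted
    field
      emb : Embedding (TailAdj l) G
      root-eq : fun emb (root l) ≡ r
      enter : Adj G x r
      outside : ∀ v → x ≢ fun emb v

  -- The two neighbours of `r` other than `x` are adjacent in `two` but not in `three`; `two≢end`
  -- uses the same test.
  two≢three : ∀ {l l′ x r} → Rooted (two ∷ l) x r → Rooted (three ∷ l′) x r → ⊥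
  two≢three (rooted φ refl xr out) (rooted ψ eq xr′ out′) =
    adjacent (other-pair (root-nbhd ψ (inj₁ 1F) (inj₁ 2F) (subst (Adj G _) (≡-sym eq) xr) refl refl (λ ()) out′)
      (subst (λ r → Nbhd r _ _ _) (≡-sym eq) (root-nbhd φ (inj₁ 1F) (inj₁ 2F) xr refl refl (λ ()) out)))
    where
    ≁ : ¬ Adj G (fun ψ (inj₁ 1F)) (fun ψ (inj₁ 2F))
    ≁ = non-adjacent (nbhd ψ (inj₁ 0F) (inj₁ 3F) (inj₁ 4F) refl refl refl (λ ()) (λ ()) (λ ())) (apart ψ (λ ())) (apart ψ (λ ())) (apart ψ (λ ()))
    adjacent : SamePair (fun ψ (inj₁ 1F)) (fun ψ (inj₁ 2F)) (fun φ (inj₁ 1F)) (fun φ (inj₁ 2F)) → ⊥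
    adjacent (straight p q) = ≁ (subst₂ (Adj G) (≡-sym p) (≡-sym q) (hom φ refl))
    adjacent (crossed p q) = ≁ (subst₂ (Adj G) (≡-sym p) (≡-sym q) (hom φ refl))

  two≢end : ∀ {l x r} → Rooted (two ∷ l) x r → Rooted [] x r → ⊥
  two≢end (rooted φ refl xr out) (rooted ψ eq xr′ out′) =
    adjacent (other-pair (root-nbhd ψ 1F 2F (subst (Adj G _) (≡-sym eq) xr) refl refl (λ ()) out′)
      (subst (λ r → Nbhd r _ _ _) (≡-sym eq) (root-nbhd φ (inj₁ 1F) (inj₁ 2F) xr refl refl (λ ()) out)))
    where
    ≁ : ¬ Adj G (fun ψ 1F) (fun ψ 2F)
    ≁ = non-adjacent (nbhd ψ 0F 3F 4F refl refl refl (λ ()) (λ ()) (λ ())) (apart ψ (λ ())) (apart ψ (λ ())) (apart ψ (λ ()))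
    adjacent : SamePair (fun ψ 1F) (fun ψ 2F) (fun φ (inj₁ 1F)) (fun φ (inj₁ 2F)) → ⊥
    adjacent (straight p q) = ≁ (subst₂ (Adj G) (≡-sym p) (≡-sym q) (hom φ refl))
    adjacent (crossed p q) = ≁ (subst₂ (Adj G) (≡-sym p) (≡-sym q) (hom φ refl))

  -- The first layers look alike. The difference appears one layer further: the two other common
  -- neighbours of that pair are adjacent only in the end piece.
  three≢end : ∀ {l x r} → Rooted (three ∷ l) x r → Rooted [] x r → ⊥
  three≢end (rooted ψ refl xr out) (rooted φ eq xr′ out′) = adjacent (other-pair
      (nbhd ψ (inj₁ 0F) (inj₁ 3F) (inj₁ 4F) refl refl refl (λ ()) (λ ()) (λ ()))
      (nb (hom ψ refl) (Adj-sym G (proj₁ (pair-both (Adj G _) pq (hom φ refl) (hom φ refl))))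
        (Adj-sym G (proj₁ (pair-both (Adj G _) pq (hom φ refl) (hom φ refl))))
        (subst (_≢ _) eq (apart φ (λ ()))) (subst (_≢ _) eq (apart φ (λ ()))) (apart φ (λ ()))))
    where
    pq : SamePair (fun ψ (inj₁ 1F)) (fun ψ (inj₁ 2F)) (fun φ 1F) (fun φ 2F)
    pq = other-pair (root-nbhd ψ (inj₁ 1F) (inj₁ 2F) xr refl refl (λ ()) out)
      (subst (λ r → Nbhd r _ _ _) eq (root-nbhd φ 1F 2F (subst (Adj G _) (≡-sym eq) xr) refl refl (λ ()) out′))
    ≁ : ¬ Adj G (fun ψ (inj₁ 3F)) (fun ψ (inj₁ 4F))
    ≁ = non-adjacent (nbhd ψ (inj₁ 1F) (inj₁ 2F) (inj₁ 5F) refl refl refl (λ ()) (λ ()) (λ ())) (apart ψ (λ ())) (apart ψ (λ ())) (apart ψ (λ ()))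
    adjacent : SamePair (fun ψ (inj₁ 3F)) (fun ψ (inj₁ 4F)) (fun φ 3F) (fun φ 4F) → ⊥
    adjacent (straight p q) = ≁ (subst₂ (Adj G) (≡-sym p) (≡-sym q) (hom φ refl))
    adjacent (crossed p q) = ≁ (subst₂ (Adj G) (≡-sym p) (≡-sym q) (hom φ refl))

  -- The first letter is determined by the adjacencies near `r`. If both readings start with the
  -- same block, they share its exit, and the reading continues over the next bridge.
  rooted-word : ∀ l l′ {x r} → Rooted l x r → Rooted l′ x r → l ≡ l′

  -- The neighbours `p` and `q` of the exit lie in the block, so the third neighbour must be the
  -- next root in both readings.
  continue : ∀ b b′ l l′ {x r x′ r′} (R : Rooted (b ∷ l) x r) (R′ : Rooted (b′ ∷ l′) x′ r′) {p q p′ q′ : Fin n} →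
    let φ = Rooted.emb R ; ψ = Rooted.emb R′ in
    SamePair p q p′ q′ →
    Nbhd (fun φ (inj₁ (exit b))) p q (fun φ (inj₂ (root l))) →
    fun ψ (inj₂ (root l′)) ≢ p′ → fun ψ (inj₂ (root l′)) ≢ q′ →
    fun ψ (inj₁ (exit b′)) ≡ fun φ (inj₁ (exit b)) → l ≡ l′
  continue b b′ l l′ (rooted φ _ _ _) (rooted ψ _ _ _) {p} {q} pq N ≢p′ ≢q′ e = rooted-word l l′
    (rooted (restrict b l φ) refl (hom φ {inj₁ (exit b)} {inj₂ (root l)} (exit-adjacent b l)) (λ v → apart φ λ ()))
    (rooted (restrict b′ l′ ψ) (third N enter (proj₁ differs) (proj₂ differs))
      (hom φ {inj₁ (exit b)} {inj₂ (root l)} (exit-adjacent b l)) (λ v → subst (_≢ _) e (apart ψ λ ())))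
    where
    enter : Adj G (fun φ (inj₁ (exit b))) (fun ψ (inj₂ (root l′)))
    enter = subst (λ v → Adj G v _) e (hom ψ {inj₁ (exit b′)} {inj₂ (root l′)} (exit-adjacent b′ l′))
    differs : fun ψ (inj₂ (root l′)) ≢ p × fun ψ (inj₂ (root l′)) ≢ q
    differs = pair-both (_ ≢_) pq ≢p′ ≢q′

  rooted-word [] [] _ _ = refl
  rooted-word [] (two ∷ l′) R R′ = ⊥-elim (two≢end R′ R)
  rooted-word [] (three ∷ l′) R R′ = ⊥-elim (three≢end R′ R)
  rooted-word (two ∷ l) [] R R′ = ⊥-elim (two≢end R R′)
  rooted-word (three ∷ l) [] R R′ = ⊥-elim (three≢end R R′)
  rooted-word (two ∷ l) (three ∷ l′) R R′ = ⊥-elim (two≢three R R′)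
  rooted-word (three ∷ l) (two ∷ l′) R R′ = ⊥-elim (two≢three R′ R)
  rooted-word (two ∷ l) (two ∷ l′) R@(rooted φ refl xr out) R′@(rooted ψ eq xr′ out′) = cong (two ∷_) (continue two two l l′ R R′ pq
      (nbhd φ (inj₁ 1F) (inj₁ 2F) (inj₂ (root l)) refl refl (exit-adjacent two l) (λ ()) (λ ()) (λ ()))
      (apart ψ (λ ())) (apart ψ (λ ())) exits)
    where
    pq : SamePair (fun φ (inj₁ 1F)) (fun φ (inj₁ 2F)) (fun ψ (inj₁ 1F)) (fun ψ (inj₁ 2F))
    pq = other-pair (root-nbhd φ (inj₁ 1F) (inj₁ 2F) xr refl refl (λ ()) out)
      (subst (λ r → Nbhd r _ _ _) eq (root-nbhd ψ (inj₁ 1F) (inj₁ 2F) (subst (Adj G _) (≡-sym eq) xr) refl refl (λ ()) out′))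
    -- The exit is recovered as the neighbour of an inner vertex that is neither the entry nor the
    -- other inner vertex.
    exits : fun ψ (inj₁ 3F) ≡ fun φ (inj₁ 3F)
    exits = third (nbhd φ (inj₁ 0F) (inj₁ 2F) (inj₁ 3F) refl refl refl (λ ()) (λ ()) (λ ()))
      (Adj-sym G (proj₁ (pair-both (Adj G (fun ψ (inj₁ 3F))) pq (hom ψ refl) (hom ψ refl))))
      (subst (_ ≢_) eq (apart ψ (λ ()))) (proj₂ (pair-both (fun ψ (inj₁ 3F) ≢_) pq (apart ψ (λ ())) (apart ψ (λ ()))))
  rooted-word (three ∷ l) (three ∷ l′) R@(rooted φ refl xr out) R′@(rooted ψ eq xr′ out′) = cong (three ∷_) (continue three three l l′ R R′ yz
      (nbhd φ (inj₁ 3F) (inj₁ 4F) (inj₂ (root l)) refl refl (exit-adjacent three l) (λ ()) (λ ()) (λ ()))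
      (apart ψ (λ ())) (apart ψ (λ ())) exits)
    where
    pq : SamePair (fun φ (inj₁ 1F)) (fun φ (inj₁ 2F)) (fun ψ (inj₁ 1F)) (fun ψ (inj₁ 2F))
    pq = other-pair (root-nbhd φ (inj₁ 1F) (inj₁ 2F) xr refl refl (λ ()) out)
      (subst (λ r → Nbhd r _ _ _) eq (root-nbhd ψ (inj₁ 1F) (inj₁ 2F) (subst (Adj G _) (≡-sym eq) xr) refl refl (λ ()) out′))
    yz : SamePair (fun φ (inj₁ 3F)) (fun φ (inj₁ 4F)) (fun ψ (inj₁ 3F)) (fun ψ (inj₁ 4F))
    yz = other-pair (nbhd φ (inj₁ 0F) (inj₁ 3F) (inj₁ 4F) refl refl refl (λ ()) (λ ()) (λ ()))
      (nb (hom φ refl)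
        (Adj-sym G (proj₁ (pair-both (Adj G (fun ψ (inj₁ 3F))) pq (hom ψ refl) (hom ψ refl))))
        (Adj-sym G (proj₁ (pair-both (Adj G (fun ψ (inj₁ 4F))) pq (hom ψ refl) (hom ψ refl))))
        (subst (_≢ _) eq (apart ψ (λ ()))) (subst (_≢ _) eq (apart ψ (λ ()))) (apart ψ (λ ())))
    exits : fun ψ (inj₁ 5F) ≡ fun φ (inj₁ 5F)
    exits = third (nbhd φ (inj₁ 1F) (inj₁ 2F) (inj₁ 5F) refl refl refl (λ ()) (λ ()) (λ ()))
      (Adj-sym G (proj₁ (pair-both (Adj G (fun ψ (inj₁ 5F))) yz (hom ψ refl) (hom ψ refl))))
      (proj₁ (pair-both (fun ψ (inj₁ 5F) ≢_) pq (apart ψ (λ ())) (apart ψ (λ ()))))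
      (proj₂ (pair-both (fun ψ (inj₁ 5F) ≢_) pq (apart ψ (λ ())) (apart ψ (λ ()))))

-- An end piece is recognised by its edge `g h`: both ends of it are joined to `c` and `e`, which
-- have `o` as a further common neighbour.
module Ends {n : ℕ} (G : Graph n) (cubic : ThreeRegular G) (π : Embedding (TailAdj []) G) where
  open Reading G cubic

  o c e g h : Fin n
  o = fun π 0F
  c = fun π 1F
  e = fun π 2F
  g = fun π 3F
  h = fun π 4F

  around-g : Nbhd g h c e
  around-g = nbhd π 4F 1F 2F refl refl refl (λ ()) (λ ()) (λ ())

  adjacent-to-h : ∀ {v} → Adj G g v → v ≢ h → Adj G h v
  adjacent-to-h gv v≢h with only around-g gv
  ... | inj₁ v≡h = contradiction v≡h v≢h
  ... | inj₂ (inj₁ refl) = hom π refl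
  ... | inj₂ (inj₂ refl) = hom π refl

  -- Among the neighbours of `g`, the vertex `h` is adjacent to the other two. So `A` cannot be `h`,
  -- and if `h` were `B` or `C` it would be adjacent to `A`.
  isolated⇒⊥ : ∀ {v A B C} → g ≡ v → Nbhd v A B C → ¬ Adj G A B → ¬ Adj G A C → ⊥
  isolated⇒⊥ refl N@(nb gA gB gC A≢B A≢C B≢C) A≁B A≁C with only N (hom π {3F} {4F} refl)
  ... | inj₁ refl = A≁B (adjacent-to-h gB (A≢B ∘ ≡-sym))
  ... | inj₂ (inj₁ refl) = A≁B (Adj-sym G (adjacent-to-h gA A≢B))
  ... | inj₂ (inj₂ refl) = A≁C (Adj-sym G (adjacent-to-h gA A≢C))

  -- Since `h` is adjacent to the other two neighbours of `g`, it cannot be one of the non-adjacent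
  -- `B` and `C`.
  twin : ∀ {v A B C} → g ≡ v → Nbhd v A B C → ¬ Adj G B C → h ≡ A × SamePair B C c e
  twin refl N@(nb gA gB gC A≢B A≢C B≢C) B≁C with only N (hom π {3F} {4F} refl)
  ... | inj₁ refl = refl , other-pair N around-g
  ... | inj₂ (inj₁ refl) = ⊥-elim (B≁C (adjacent-to-h gC (B≢C ∘ ≡-sym)))
  ... | inj₂ (inj₂ refl) = ⊥-elim (B≁C (Adj-sym G (adjacent-to-h gB B≢C)))

  meets : ∀ {B C} → SamePair B C c e → Adj G B o × Adj G C o
  meets pq = pair-both (λ v → Adj G v o) pq (hom π refl) (hom π refl)

  o≢g : ∀ {v} → g ≡ v → o ≢ v
  o≢g refl = Reading.apart G cubic π λ ()

  o≢h : ∀ {v} → h ≡ v → o ≢ v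
  o≢h refl = Reading.apart G cubic π λ ()

  AtEnd : ∀ {l} → Embedding (TailAdj l) G → Set
  AtEnd {l} φ = o ≡ fun φ (endOf l 0F) × SamePair (fun φ (endOf l 1F)) (fun φ (endOf l 2F)) c e

  -- No vertex of `three` has two adjacent neighbours, so `g` is not there. In `two` the inner edge
  -- resembles `g h`, but entry and exit have no common neighbour that could serve as `o`.
  only-at-end : ∀ l {x r} (R : Rooted l x r) w → g ≡ fun (Rooted.emb R) w → AtEnd (Rooted.emb R)
  only-at-end [] {x} (rooted φ refl xr out) w eq = go w eq
    where
    N₁ = nbhd φ {1F} 0F 3F 4F refl refl refl (λ ()) (λ ()) (λ ())
    N₂ = nbhd φ {2F} 0F 3F 4F refl refl refl (λ ()) (λ ()) (λ ())
    N₃ = nbhd φ {3F} 4F 1F 2F refl refl refl (λ ()) (λ ()) (λ ())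
    N₄ = nbhd φ {4F} 3F 1F 2F refl refl refl (λ ()) (λ ()) (λ ())
    1≁2 = non-adjacent N₁ (apart φ λ ()) (apart φ λ ()) (apart φ λ ())
    0≁3 : ¬ Adj G (fun φ 0F) (fun φ 3F)
    0≁3 = non-adjacent N₃ (apart φ λ ()) (apart φ λ ()) (apart φ λ ()) ∘ Adj-sym G
    0≁4 : ¬ Adj G (fun φ 0F) (fun φ 4F)
    0≁4 = non-adjacent N₄ (apart φ λ ()) (apart φ λ ()) (apart φ λ ()) ∘ Adj-sym G
    go : ∀ w → g ≡ fun φ w → AtEnd φ
    go 0F eq = ⊥-elim (isolated⇒⊥ eq (root-nbhd φ 1F 2F xr refl refl (λ ()) out)
      (non-adjacent N₁ (out _) (out _) (out _) ∘ Adj-sym G) (non-adjacent N₂ (out _) (out _) (out _) ∘ Adj-sym G))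
    go 1F eq = ⊥-elim (isolated⇒⊥ eq N₁ 0≁3 0≁4)
    go 2F eq = ⊥-elim (isolated⇒⊥ eq N₂ 0≁3 0≁4)
    go 3F eq with twin eq N₃ 1≁2
    ... | h≡ , pq = third (nbhd φ {1F} 3F 4F 0F refl refl refl (λ ()) (λ ()) (λ ())) (proj₁ (meets pq)) (o≢g eq) (o≢h h≡) , pq
    go 4F eq with twin eq N₄ 1≁2
    ... | h≡ , pq = third (nbhd φ {1F} 3F 4F 0F refl refl refl (λ ()) (λ ()) (λ ())) (proj₁ (meets pq)) (o≢h h≡) (o≢g eq) , pq
  only-at-end (b ∷ l) (rooted φ refl xr out) (inj₂ w) eq =
    only-at-end l (rooted (restrict b l φ) refl (hom φ {inj₁ (exit b)} {inj₂ (root l)} (exit-adjacent b l)) (λ v → apart φ λ ())) w eq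
  only-at-end (two ∷ l) {x} (rooted φ refl xr out) (inj₁ w) eq = ⊥-elim (go w eq)
    where
    N₀ = root-nbhd φ (inj₁ 1F) (inj₁ 2F) xr refl refl (λ ()) out
    N₁ = nbhd φ {inj₁ 1F} (inj₁ 2F) (inj₁ 0F) (inj₁ 3F) refl refl refl (λ ()) (λ ()) (λ ())
    N₂ = nbhd φ {inj₁ 2F} (inj₁ 1F) (inj₁ 0F) (inj₁ 3F) refl refl refl (λ ()) (λ ()) (λ ())
    N₃ = nbhd φ {inj₁ 3F} (inj₂ (root l)) (inj₁ 1F) (inj₁ 2F) (exit-adjacent two l) refl refl (λ ()) (λ ()) (λ ())
    0≁3 = non-adjacent N₀ (out _ ∘ ≡-sym) (apart φ λ ()) (apart φ λ ())
    -- o would be both outside and inside the tail.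
    through : ∀ {u v} → o ≢ fun φ (inj₁ 1F) → o ≢ fun φ (inj₁ 2F) → SamePair (fun φ (inj₁ 0F)) (fun φ (inj₁ 3F)) u v →
      (∀ {B C} → SamePair B C u v → Adj G B o × Adj G C o) → ⊥
    through o≢1 o≢2 pq m with only N₀ (proj₁ (m pq)) | only N₃ (proj₂ (m pq))
    ... | inj₁ p | inj₁ q = out _ (trans (≡-sym p) q)
    ... | inj₁ _ | inj₂ (inj₁ q) = o≢1 q
    ... | inj₁ _ | inj₂ (inj₂ q) = o≢2 q
    ... | inj₂ (inj₁ p) | _ = o≢1 p
    ... | inj₂ (inj₂ p) | _ = o≢2 p
    go : ∀ w → g ≡ fun φ (inj₁ w) → ⊥
    go 0F eq = isolated⇒⊥ eq N₀ (non-adjacent N₁ (out _) (out _) (out _) ∘ Adj-sym G) (non-adjacent N₂ (out _) (out _) (out _) ∘ Adj-sym G)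
    go 1F eq with twin eq N₁ 0≁3
    ... | h≡ , pq = through (o≢g eq) (o≢h h≡) pq meets
    go 2F eq with twin eq N₂ 0≁3
    ... | h≡ , pq = through (o≢h h≡) (o≢g eq) pq meets
    go 3F eq = isolated⇒⊥ eq N₃ (non-adjacent N₁ (apart φ λ ()) (apart φ λ ()) (apart φ λ ()) ∘ Adj-sym G)
      (non-adjacent N₂ (apart φ λ ()) (apart φ λ ()) (apart φ λ ()) ∘ Adj-sym G)
  only-at-end (three ∷ l) {x} (rooted φ refl xr out) (inj₁ w) eq = ⊥-elim (go w eq)
    where
    N₀ = root-nbhd φ (inj₁ 1F) (inj₁ 2F) xr refl refl (λ ()) out
    N₁ = nbhd φ {inj₁ 1F} (inj₁ 0F) (inj₁ 3F) (inj₁ 4F) refl refl refl (λ ()) (λ ()) (λ ())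
    N₂ = nbhd φ {inj₁ 2F} (inj₁ 0F) (inj₁ 3F) (inj₁ 4F) refl refl refl (λ ()) (λ ()) (λ ())
    N₃ = nbhd φ {inj₁ 3F} (inj₁ 5F) (inj₁ 1F) (inj₁ 2F) refl refl refl (λ ()) (λ ()) (λ ())
    N₄ = nbhd φ {inj₁ 4F} (inj₁ 5F) (inj₁ 1F) (inj₁ 2F) refl refl refl (λ ()) (λ ()) (λ ())
    N₅ = nbhd φ {inj₁ 5F} (inj₂ (root l)) (inj₁ 3F) (inj₁ 4F) (exit-adjacent three l) refl refl (λ ()) (λ ()) (λ ())
    0≁3 : ¬ Adj G (fun φ (inj₁ 0F)) (fun φ (inj₁ 3F))
    0≁3 = non-adjacent N₃ (apart φ λ ()) (apart φ λ ()) (apart φ λ ()) ∘ Adj-sym G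
    0≁4 : ¬ Adj G (fun φ (inj₁ 0F)) (fun φ (inj₁ 4F))
    0≁4 = non-adjacent N₄ (apart φ λ ()) (apart φ λ ()) (apart φ λ ()) ∘ Adj-sym G
    5≁1 : ¬ Adj G (fun φ (inj₁ 5F)) (fun φ (inj₁ 1F))
    5≁1 = non-adjacent N₁ (apart φ λ ()) (apart φ λ ()) (apart φ λ ()) ∘ Adj-sym G
    5≁2 : ¬ Adj G (fun φ (inj₁ 5F)) (fun φ (inj₁ 2F))
    5≁2 = non-adjacent N₂ (apart φ λ ()) (apart φ λ ()) (apart φ λ ()) ∘ Adj-sym G
    go : ∀ w → g ≡ fun φ (inj₁ w) → ⊥
    go 0F eq = isolated⇒⊥ eq N₀ (non-adjacent N₁ (out _) (out _) (out _) ∘ Adj-sym G) (non-adjacent N₂ (out _) (out _) (out _) ∘ Adj-sym G)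
    go 1F eq = isolated⇒⊥ eq N₁ 0≁3 0≁4
    go 2F eq = isolated⇒⊥ eq N₂ 0≁3 0≁4
    go 3F eq = isolated⇒⊥ eq N₃ 5≁1 5≁2
    go 4F eq = isolated⇒⊥ eq N₄ 5≁1 5≁2
    go 5F eq = isolated⇒⊥ eq N₅ (non-adjacent N₃ (apart φ λ ()) (apart φ λ ()) (apart φ λ ()) ∘ Adj-sym G)
      (non-adjacent N₄ (apart φ λ ()) (apart φ λ ()) (apart φ λ ()) ∘ Adj-sym G)

module _ {n : ℕ} (G : Graph n) (cubic : ThreeRegular G) where
  open Reading G cubic

  right-rooted : ∀ l l′ (φ : Embedding (JoinedAdj l l′) G) → Rooted l′ (fun φ (inj₁ (root l))) (fun φ (inj₂ (root l′)))
  right-rooted l l′ φ = rooted (rightPart l l′ φ) refl (hom φ {inj₁ (root l)} {inj₂ (root l′)} (roots-adjacent l l′)) (λ v → apart φ λ ())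

  left-rooted : ∀ l l′ (φ : Embedding (JoinedAdj l l′) G) → Rooted l (fun φ (inj₂ (root l′))) (fun φ (inj₁ (root l)))
  left-rooted l l′ φ = rooted (leftPart l l′ φ) refl (Adj-sym G (hom φ {inj₁ (root l)} {inj₂ (root l′)} (roots-adjacent l l′))) (λ v → apart φ λ ())

  same-left-end : ∀ l l′ (σ : Embedding (JoinedAdj [] l) G) (ψ : Embedding (JoinedAdj [] l′) G) →
    fun σ (inj₁ 0F) ≡ fun ψ (inj₁ 0F) →
    SamePair (fun ψ (inj₁ 1F)) (fun ψ (inj₁ 2F)) (fun σ (inj₁ 1F)) (fun σ (inj₁ 2F)) → l ≡ l′
  same-left-end l l′ σ ψ eq pq = rooted-word l l′ (right-rooted [] l σ)
    (subst₂ (Rooted l′) (≡-sym eq) (≡-sym roots) (right-rooted [] l′ ψ))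
    where
    differs = pair-both (fun σ (inj₂ (root l)) ≢_) pq (apart σ (λ ())) (apart σ (λ ()))
    roots : fun σ (inj₂ (root l)) ≡ fun ψ (inj₂ (root l′))
    roots = third (nbhd ψ {inj₁ 0F} (inj₁ 1F) (inj₁ 2F) (inj₂ (root l′)) refl refl (roots-adjacent [] l′) (λ ()) (λ ()) (λ ()))
      (subst (λ v → Adj G v _) eq (hom σ {inj₁ 0F} {inj₂ (root l)} (roots-adjacent [] l))) (proj₁ differs) (proj₂ differs)

-- The vertex `g` of the embedded left end must fall into one of the two end pieces of `chain l′`.
-- Reading from there gives `l′` on the left and its reversal on the right.
chain-words : ∀ l l′ → Embedding (JoinedAdj [] l) (chain l′) → l ≡ l′ ⊎ l ≡ reverse l′
chain-words l l′ σ = locate (decodeJ [] l′ g) (≡-sym (encodeJ-decodeJ [] l′ g))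
  where
  G = chain l′
  cubic = joined-cubic [] l′
  ι = encoding [] l′
  open Ends G cubic (leftPart [] l σ)
  locate : ∀ w → g ≡ fun ι w → l ≡ l′ ⊎ l ≡ reverse l′
  locate (inj₁ w) eq with only-at-end [] (left-rooted G cubic [] l′ ι) w eq
  ... | o≡ , pq = inj₁ (same-left-end G cubic l l′ σ ι o≡ pq)
  locate (inj₂ w) eq with only-at-end l′ (right-rooted G cubic [] l′ ι) w eq
  ... | o≡ , pq = inj₂ (same-left-end G cubic l (reverse l′) σ (reversed l′ ι)
    (trans o≡ (≡-sym (end 0F))) (subst₂ (λ a b → SamePair a b c e) (≡-sym (end 1F)) (≡-sym (end 2F)) pq))
    where
    end : ∀ u → fun (reversed l′ ι) (inj₁ u) ≡ fun ι (inj₂ (endOf l′ u))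
    end = gather-end l′ [] ι

-- Counting up to an equivalence

-- A record, so that the predicate and the relation can be inferred from its type.
record Counted {A : Set} (P : A → Set) (_~_ : A → A → Set) (k : ℕ) : Set where
  constructor counted
  field
    enumeration : CountUpTo P _~_ k

module _ {A : Set} {P : A → Set} {_~_ : A → A → Set} where

  count-unique : (∀ {x y} → x ~ y → y ~ x) → (∀ {x y z} → x ~ y → y ~ z → x ~ z) →
    ∀ {j k} → Counted P _~_ j → Counted P _~_ k → j ≡ k
  count-unique ~-sym ~-trans c d = ≤-antisym (le c d) (le d c)
    where
    le : ∀ {j k} → Counted P _~_ j → Counted P _~_ k → j ≤ k
    le (counted (f , Pf , f-inj , _)) (counted (g , _ , _ , g-cov)) = Fin.injective⇒≤ {f = λ i → proj₁ (g-cov (f i) (Pf i))} λ {i} {i′} e →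
      f-inj i i′ (~-trans (proj₂ (g-cov (f i) (Pf i)))
        (~-sym (subst (λ j → f i′ ~ g j) (≡-sym e) (proj₂ (g-cov (f i′) (Pf i′))))))

  count-none : (∀ x → ¬ P x) → Counted P _~_ 0
  count-none none = counted ((λ ()) , (λ ()) , (λ ()) , λ x Px → ⊥-elim (none x Px))

  count-one : ∀ x → P x → (∀ y → P y → y ~ x) → Counted P _~_ 1
  count-one x Px all = counted ((λ _ → x) , (λ _ → Px) , (λ { 0F 0F _ → refl }) , λ y Py → 0F , all y Py)

  -- Coverage is required for every `z` with `y ≈ z`, because the given enumeration decides which
  -- representative of the class of `y` is listed.
  count-map : ∀ {B : Set} {Q : B → Set} {_≈_ : B → B → Set} {k} (g : ∀ y → Q y → A) →
    Counted Q _≈_ k → (∀ y Qy → P (g y Qy)) → (∀ y y′ Qy Qy′ → g y Qy ~ g y′ Qy′ → y ≈ y′) →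
    (∀ x → P x → ∃ λ y → Q y × (∀ z Qz → y ≈ z → x ~ g z Qz)) → Counted P _~_ k
  count-map g (counted (f , Qf , inj , cov)) Pg reflects covers = counted (
    (λ i → g (f i) (Qf i)) , (λ i → Pg (f i) (Qf i)) , (λ i j e → inj i j (reflects _ _ _ _ e)) ,
    λ x Px → let (y , Qy , close) = covers x Px ; (i , y≈) = cov y Qy in i , close (f i) (Qf i) y≈)

  count-join : ∀ {B C : Set} {Q : B → Set} {R : C → Set} {_≈₁_ : B → B → Set} {_≈₂_ : C → C → Set} {j k}
    (g : B → A) (h : C → A) → Counted Q _≈₁_ j → Counted R _≈₂_ k →
    (∀ y → Q y → P (g y)) → (∀ z → R z → P (h z)) →
    (∀ y y′ → g y ~ g y′ → y ≈₁ y′) → (∀ z z′ → h z ~ h z′ → z ≈₂ z′) →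
    (∀ y z → Q y → R z → ¬ (g y ~ h z)) → (∀ y z → Q y → R z → ¬ (h z ~ g y)) →
    (∀ x → P x → (∃ λ y → Q y × (∀ y′ → y ≈₁ y′ → x ~ g y′)) ⊎ (∃ λ z → R z × (∀ z′ → z ≈₂ z′ → x ~ h z′))) →
    Counted P _~_ (j + k)
  count-join {j = j} {k} g h (counted (f₁ , Qf₁ , inj₁′ , cov₁)) (counted (f₂ , Rf₂ , inj₂′ , cov₂)) Pg Ph g-refl h-refl g≁h h≁g covers = counted (
    f ∘ splitAt j , (λ i → Pf (splitAt j i)) ,
    (λ i i′ e → trans (≡-sym (Fin.join-splitAt j k i)) (trans (cong (join j k) (f-inj (splitAt j i) (splitAt j i′) e)) (Fin.join-splitAt j k i′))) ,
    cov)
    where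
    f : Fin j ⊎ Fin k → A
    f (inj₁ i) = g (f₁ i)
    f (inj₂ i) = h (f₂ i)
    Pf : ∀ i → P (f i)
    Pf (inj₁ i) = Pg _ (Qf₁ i)
    Pf (inj₂ i) = Ph _ (Rf₂ i)
    f-inj : ∀ i i′ → f i ~ f i′ → i ≡ i′
    f-inj (inj₁ i) (inj₁ i′) e = cong inj₁ (inj₁′ i i′ (g-refl _ _ e))
    f-inj (inj₁ i) (inj₂ i′) e = ⊥-elim (g≁h _ _ (Qf₁ i) (Rf₂ i′) e)
    f-inj (inj₂ i) (inj₁ i′) e = ⊥-elim (h≁g _ _ (Qf₁ i′) (Rf₂ i) e)
    f-inj (inj₂ i) (inj₂ i′) e = cong inj₂ (inj₂′ i i′ (h-refl _ _ e))
    cov : ∀ x → P x → ∃ λ i → x ~ f (splitAt j i)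
    cov x Px with covers x Px
    ... | inj₁ (y , Qy , close) with cov₁ y Qy
    ...   | i , y≈ = i ↑ˡ k , subst (λ s → x ~ f s) (≡-sym (Fin.splitAt-↑ˡ j i k)) (close _ y≈)
    cov x Px | inj₂ (z , Rz , close) with cov₂ z Rz
    ...   | i , z≈ = j ↑ʳ i , subst (λ s → x ~ f s) (≡-sym (Fin.splitAt-↑ʳ j k i)) (close _ z≈)

-- Words in the two blocks, all of them and up to reversal.

part : Block → ℕ
part two = 2
part three = 3

weight : List Block → ℕ
weight [] = 0
weight (b ∷ l) = part b + weight l

weight-++ : ∀ l l′ → weight (l ++ l′) ≡ weight l + weight l′
weight-++ [] l′ = refl
weight-++ (b ∷ l) l′ = trans (cong (part b +_) (weight-++ l l′)) (≡-sym (+-assoc (part b) _ _))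

weight-reverse : ∀ l → weight (reverse l) ≡ weight l
weight-reverse [] = refl
weight-reverse (b ∷ l) = begin
  weight (reverse (b ∷ l))              ≡⟨ cong weight (List.unfold-reverse b l) ⟩
  weight (reverse l ∷ʳ b)               ≡⟨ weight-++ (reverse l) (b ∷ []) ⟩
  weight (reverse l) + (part b + 0)     ≡⟨ cong₂ _+_ (weight-reverse l) (+-identityʳ (part b)) ⟩
  weight l + part b                     ≡⟨ +-comm (weight l) (part b) ⟩
  part b + weight l                     ∎
  where open ≡-Reasoning

-- A shift of the Padovan numbers; the recursion removes the first letter.
compositions : ℕ → ℕ
compositions 0 = 1
compositions 1 = 0
compositions 2 = 1
compositions (suc (suc (suc x))) = compositions (suc x) + compositions x

count-words : ∀ m → Counted (λ l → weight l ≡ m) _≡_ (compositions m)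
count-words 0 = count-one [] refl λ { [] _ → refl ; (two ∷ _) () ; (three ∷ _) () }
count-words 1 = count-none λ { [] () ; (two ∷ _) () ; (three ∷ _) () }
count-words 2 = count-one (two ∷ []) refl λ { [] () ; (two ∷ []) _ → refl ; (two ∷ two ∷ _) () ; (two ∷ three ∷ _) () ; (three ∷ _) () }
count-words (suc (suc (suc x))) = count-join (two ∷_) (three ∷_) (count-words (suc x)) (count-words x)
  (λ y → cong (2 +_)) (λ z → cong (3 +_)) (λ y y′ → List.∷-injectiveʳ) (λ z z′ → List.∷-injectiveʳ) (λ _ _ _ _ ()) (λ _ _ _ _ ())
  λ { [] () ; (two ∷ l) e → inj₁ (l , suc-injective (suc-injective e) , λ _ → cong (two ∷_))
    ; (three ∷ l) e → inj₂ (l , suc-injective (suc-injective (suc-injective e)) , λ _ → cong (three ∷_)) }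

part-injective : Injective part
part-injective {two} {two} _ = refl
part-injective {three} {three} _ = refl

count-compositions : ∀ x → Counted (IsComposition23 x) _≡_ (compositions x)
count-compositions x = count-map (λ l _ → map part l) (count-words x)
  (λ l e → parts l , trans (sum-parts l) e)
  (λ l l′ _ _ → List.map-injective part-injective)
  λ { ps (as , e) → let (l , p) = blocks as in l , trans (≡-sym (sum-parts l)) (trans (cong ℕ.sum (≡-sym p)) e) , λ { z _ refl → p } }
  where
  parts : ∀ l → All (λ p → p ≡ 2 ⊎ p ≡ 3) (map part l)
  parts [] = []
  parts (two ∷ l) = inj₁ refl ∷ parts l
  parts (three ∷ l) = inj₂ refl ∷ parts l
  sum-parts : ∀ l → ℕ.sum (map part l) ≡ weight l
  sum-parts [] = refl
  sum-parts (b ∷ l) = cong (part b +_) (sum-parts l)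
  blocks : ∀ {ps} → All (λ p → p ≡ 2 ⊎ p ≡ 3) ps → ∃ λ l → ps ≡ map part l
  blocks [] = [] , refl
  blocks (inj₁ refl ∷ as) = let (l , e) = blocks as in two ∷ l , cong (2 ∷_) e
  blocks (inj₂ refl ∷ as) = let (l , e) = blocks as in three ∷ l , cong (3 ∷_) e

_≈_ : List Block → List Block → Set
l ≈ l′ = l ≡ l′ ⊎ l ≡ reverse l′

wrap : Block → List Block → Block → List Block
wrap b l b′ = b ∷ (l ∷ʳ b′)

weight-wrap : ∀ b l b′ → weight (wrap b l b′) ≡ part b + (part b′ + weight l)
weight-wrap b l b′ = cong (part b +_) (trans (weight-++ l (b′ ∷ [])) (trans (cong (weight l +_) (+-identityʳ (part b′))) (+-comm (weight l) (part b′))))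

reverse-wrap : ∀ b l b′ → reverse (wrap b l b′) ≡ wrap b′ (reverse l) b
reverse-wrap b l b′ = trans (List.unfold-reverse b (l ∷ʳ b′)) (cong (_∷ʳ b) (List.reverse-++ l (b′ ∷ [])))

wrap-injective : ∀ {b l b′ c l′ c′} → wrap b l b′ ≡ wrap c l′ c′ → b ≡ c × b′ ≡ c′ × l ≡ l′
wrap-injective {l = l} {l′ = l′} e with List.∷-injective e
... | p , q with List.∷ʳ-injective l l′ q
...   | r , s = p , s , r

wrap-≈ : ∀ {b l b′ c l′ c′} → wrap b l b′ ≈ wrap c l′ c′ → (b ≡ c × b′ ≡ c′ × l ≡ l′) ⊎ (b ≡ c′ × b′ ≡ c × l ≡ reverse l′)
wrap-≈ (inj₁ e) = inj₁ (wrap-injective e)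
wrap-≈ {c = c} {l′} {c′} (inj₂ e) = inj₂ (wrap-injective (trans e (reverse-wrap c l′ c′)))

wrap-cong-≈ : ∀ b {l l′} → l ≈ l′ → wrap b l b ≈ wrap b l′ b
wrap-cong-≈ b (inj₁ refl) = inj₁ refl
wrap-cong-≈ b {l′ = l′} (inj₂ refl) = inj₂ (≡-sym (reverse-wrap b l′ b))

wrap-reflects-≈ : ∀ b l l′ → wrap b l b ≈ wrap b l′ b → l ≈ l′
wrap-reflects-≈ b l l′ e with wrap-≈ {b} {l} {b} {b} {l′} {b} e
... | inj₁ (_ , _ , p) = inj₁ p
... | inj₂ (_ , _ , p) = inj₂ p

-- A word of weight at least 4 has at least two letters, since a single letter weighs at most 3.
unwrap : ∀ {m} l → weight l ≡ 4 + m → ∃ λ b → ∃ λ l′ → ∃ λ b′ → l ≡ wrap b l′ b′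
unwrap (b ∷ l) e with initLast l
unwrap (two ∷ .[]) () | []
unwrap (three ∷ .[]) () | []
unwrap (b ∷ .(l ∷ʳ b′)) e | l ∷ʳ′ b′ = b , l , b′ , refl

-- Peel off both ends: equal ends leave a word up to reversal, distinct
-- ends can be ordered as two, three and then leave an arbitrary word.
classes : ℕ → ℕ
classes 0 = 1
classes 1 = 0
classes 2 = 1
classes 3 = 1
classes 4 = 1
classes 5 = 1
classes (suc (suc (suc (suc (suc (suc m)))))) = (classes (suc (suc m)) + classes m) + compositions (suc m)

Balanced : ℕ → List Block → Set
Balanced m l = ∃ λ b → ∃ λ l′ → l ≡ wrap b l′ b × weight l ≡ m

count-balanced : ∀ m {j k} → Counted (λ l → weight l ≡ 2 + m) _≈_ j → Counted (λ l → weight l ≡ m) _≈_ k →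
  Counted (Balanced (6 + m)) _≈_ (j + k)
count-balanced m shorter₂ shorter₃ = count-join (λ l → wrap two l two) (λ l → wrap three l three) shorter₂ shorter₃
  (λ l e → two , l , refl , trans (weight-wrap two l two) (cong (4 +_) e))
  (λ l e → three , l , refl , trans (weight-wrap three l three) (cong (6 +_) e))
  (wrap-reflects-≈ two) (wrap-reflects-≈ three)
  (λ { y z _ _ (inj₂ e) → different₁ y z e }) (λ { y z _ _ (inj₂ e) → different₂ y z e })
  λ { _ (two , l , refl , e) → inj₁ (l , +-cancelˡ-≡ 4 _ _ (trans (≡-sym (weight-wrap two l two)) e) , λ _ → wrap-cong-≈ two)
    ; _ (three , l , refl , e) → inj₂ (l , +-cancelˡ-≡ 6 _ _ (trans (≡-sym (weight-wrap three l three)) e) , λ _ → wrap-cong-≈ three) }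
  where
  different₁ : ∀ y z → wrap two y two ≢ reverse (wrap three z three)
  different₁ y z e with trans e (reverse-wrap three z three)
  ... | ()
  different₂ : ∀ y z → wrap three z three ≢ reverse (wrap two y two)
  different₂ y z e with trans e (reverse-wrap two y two)
  ... | ()

count-classes : ∀ m → Counted (λ l → weight l ≡ m) _≈_ (classes m)
count-classes 0 = count-one [] refl λ { [] _ → inj₁ refl ; (two ∷ _) () ; (three ∷ _) () }
count-classes 1 = count-none λ { [] () ; (two ∷ _) () ; (three ∷ _) () }
count-classes 2 = count-one (two ∷ []) refl λ { [] () ; (two ∷ []) _ → inj₁ refl ; (two ∷ two ∷ _) () ; (two ∷ three ∷ _) () ; (three ∷ _) () }
count-classes 3 = count-one (three ∷ []) refl λ
  { [] () ; (two ∷ []) () ; (two ∷ two ∷ _) () ; (two ∷ three ∷ _) () ; (three ∷ []) _ → inj₁ refl ; (three ∷ two ∷ _) () ; (three ∷ three ∷ _) () }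
count-classes 4 = count-one (two ∷ two ∷ []) refl λ
  { [] () ; (two ∷ []) () ; (two ∷ two ∷ []) _ → inj₁ refl ; (two ∷ two ∷ two ∷ _) () ; (two ∷ two ∷ three ∷ _) () ; (two ∷ three ∷ _) ()
  ; (three ∷ []) () ; (three ∷ two ∷ _) () ; (three ∷ three ∷ _) () }
count-classes 5 = count-one (two ∷ three ∷ []) refl λ
  { [] () ; (two ∷ []) () ; (two ∷ two ∷ []) () ; (two ∷ two ∷ two ∷ _) () ; (two ∷ two ∷ three ∷ _) ()
  ; (two ∷ three ∷ []) _ → inj₁ refl ; (two ∷ three ∷ two ∷ _) () ; (two ∷ three ∷ three ∷ _) ()
  ; (three ∷ []) () ; (three ∷ two ∷ []) _ → inj₂ refl ; (three ∷ two ∷ two ∷ _) () ; (three ∷ two ∷ three ∷ _) () ; (three ∷ three ∷ _) () }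
count-classes (suc (suc (suc (suc (suc (suc m)))))) = count-join id (λ l → wrap two l three)
  (count-balanced m (count-classes (suc (suc m))) (count-classes m)) (count-words (1 + m))
  (λ { _ (_ , _ , _ , e) → e }) (λ l e → trans (weight-wrap two l three) (cong (5 +_) e))
  (λ _ _ e → e) reflects apart₁ apart₂ covers
  where
  reflects : ∀ l l′ → wrap two l three ≈ wrap two l′ three → l ≡ l′
  reflects l l′ e with wrap-≈ {two} {l} {three} {two} {l′} {three} e
  ... | inj₁ (_ , _ , p) = p
  ... | inj₂ (() , _)
  apart₁ : ∀ l l′ → Balanced (6 + m) l → weight l′ ≡ 1 + m → ¬ (l ≈ wrap two l′ three)
  apart₁ _ l′ (b , l , refl , _) _ e with wrap-≈ {b} {l} {b} {two} {l′} {three} e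
  ... | inj₁ (refl , () , _)
  ... | inj₂ (refl , () , _)
  apart₂ : ∀ l l′ → Balanced (6 + m) l → weight l′ ≡ 1 + m → ¬ (wrap two l′ three ≈ l)
  apart₂ _ l′ (b , l , refl , _) _ e with wrap-≈ {two} {l′} {three} {b} {l} {b} e
  ... | inj₁ (refl , () , _)
  ... | inj₂ (refl , () , _)
  covers : ∀ l → weight l ≡ 6 + m →
    (∃ λ l′ → Balanced (6 + m) l′ × (∀ z → l′ ≈ z → l ≈ z)) ⊎ (∃ λ l′ → weight l′ ≡ 1 + m × (∀ z → l′ ≡ z → l ≈ wrap two z three))
  covers l e with unwrap l e
  ... | two , l′ , two , refl = inj₁ (l , (two , l′ , refl , e) , λ _ p → p)
  ... | three , l′ , three , refl = inj₁ (l , (three , l′ , refl , e) , λ _ p → p)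
  ... | two , l′ , three , refl = inj₂ (l′ , +-cancelˡ-≡ 5 _ _ (trans (≡-sym (weight-wrap two l′ three)) e) , λ { _ refl → inj₁ refl })
  -- Such a word is represented by its reversal, which begins with `two` and ends with `three`.
  ... | three , l′ , two , refl = inj₂ (reverse l′ ,
    trans (weight-reverse l′) (+-cancelˡ-≡ 5 _ _ (trans (≡-sym (weight-wrap three l′ two)) e)) ,
    λ { _ refl → inj₂ (trans (cong (λ k → wrap three k two) (≡-sym (List.reverse-involutive l′))) (≡-sym (reverse-wrap two (reverse l′) three))) })

-- Expand all three terms by the recursion of `classes`: the cases `i − 2` and `i − 3` account for
-- the lags 4 and 6, and the remaining `compositions` cancel by their own recursion. The lag 3 in
-- `i` requires three initial cases.
classes-even : ∀ i → classes (6 + i * 2) ≡ classes (4 + i * 2) + classes (3 + i * 2)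
classes-even 0 = refl
classes-even 1 = refl
classes-even 2 = refl
classes-even (suc (suc (suc i)))
  rewrite classes-even (suc i) | classes-even i =
  regroup (classes (4 + i * 2)) (classes (3 + i * 2)) (classes (5 + i * 2)) (compositions (5 + i * 2)) (compositions (4 + i * 2))
  where
  regroup : ∀ a b c d e → (((a + b) + c) + (a + b)) + (d + e) ≡ (((a + b) + a) + d) + ((c + b) + e)
  regroup = solve-∀

-- As in the even case. The extra term also fits: `compositions` has lags 2 and 3, precisely the
-- steps by which `i` decreases.
classes-odd : ∀ i → classes (7 + i * 2) + compositions (1 + i) ≡ classes (5 + i * 2) + classes (4 + i * 2)
classes-odd 0 = refl
classes-odd 1 = refl
classes-odd 2 = refl
classes-odd (suc (suc (suc i))) = begin
  ((c₉ + c₇) + (t₆ + t₅)) + (compositions (2 + i) + compositions (1 + i))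
    ≡⟨ regroup c₉ c₇ (t₆ + t₅) (compositions (2 + i)) (compositions (1 + i)) ⟩
  (c₉ + compositions (2 + i)) + (c₇ + compositions (1 + i)) + (t₆ + t₅)
    ≡⟨ cong (_+ (t₆ + t₅)) (cong₂ _+_ (classes-odd (suc i)) (classes-odd i)) ⟩
  (c₇ + c₆) + (c₅ + c₄) + (t₆ + t₅)
    ≡⟨ regroup′ c₇ c₆ c₅ c₄ t₆ t₅ ⟩
  ((c₇ + c₅) + t₆) + ((c₆ + c₄) + t₅) ∎
  where
  open ≡-Reasoning
  c₄ = classes (4 + i * 2)
  c₅ = classes (5 + i * 2)
  c₆ = classes (6 + i * 2)
  c₇ = classes (7 + i * 2)
  c₉ = classes (9 + i * 2)
  t₅ = compositions (5 + i * 2)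
  t₆ = compositions (6 + i * 2)
  regroup : ∀ a b t x y → ((a + b) + t) + (x + y) ≡ (a + x) + (b + y) + t
  regroup = solve-∀
  regroup′ : ∀ a b c d x y → (a + b) + (c + d) + (x + y) ≡ ((a + c) + x) + ((b + d) + y)
  regroup′ = solve-∀

-- The number of classes

iso-sym : {G H : Graph n} → Iso G H → Iso H G
iso-sym {G = G} {H} (σ , pres) = flip σ , λ i j → trans
  (≡-sym (cong₂ (adj H) (inverseʳ σ) (inverseʳ σ))) (≡-sym (pres (σ ⟨$⟩ˡ i) (σ ⟨$⟩ˡ j)))

iso-trans : {G H K : Graph n} → Iso G H → Iso H K → Iso G K
iso-trans (σ , p) (τ , q) = σ ∘ₚ τ , λ i j → trans (p i j) (q (σ ⟨$⟩ʳ i) (σ ⟨$⟩ʳ j))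

embedding-iso : {V : Set} {_∼_ : V → V → Set} {G H : Graph n} → Embedding _∼_ G → Iso G H → Embedding _∼_ H
fun (embedding-iso φ (σ , pres)) u = σ ⟨$⟩ʳ fun φ u
injective (embedding-iso φ (σ , pres)) e = injective φ (trans (≡-sym (inverseˡ σ)) (trans (cong (σ ⟨$⟩ˡ_) e) (inverseˡ σ)))
hom (embedding-iso φ (σ , pres)) a = trans (≡-sym (pres _ _)) (hom φ a)

resize : m ≡ n → Graph m → Graph n
resize = subst Graph

resize-cubicConnPerm : (e : m ≡ n) {G : Graph m} → CubicConnPerm G → CubicConnPerm (resize e G)
resize-cubicConnPerm refl p = p

into-resize : (e : m ≡ n) {V : Set} {_∼_ : V → V → Set} {G : Graph m} → Embedding _∼_ G → Embedding _∼_ (resize e G)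
into-resize refl φ = φ

out-of-resize : (e : m ≡ n) {V : Set} {_∼_ : V → V → Set} {G : Graph m} → Embedding _∼_ (resize e G) → Embedding _∼_ G
out-of-resize refl φ = φ

from-resize : ∀ {k} (e : m ≡ n) {G : Graph m} {H : Graph k} → Embedding (Adj G) H → Embedding (Adj (resize e G)) H
from-resize refl φ = φ

chain-size : ∀ l → 5 + tailSize l ≡ 10 + weight l * 2
chain-size l = cong (5 +_) (tail l)
  where
  tail : ∀ l → tailSize l ≡ 5 + weight l * 2
  tail [] = refl
  tail (two ∷ l) = cong (4 +_) (tail l)
  tail (three ∷ l) = cong (6 +_) (tail l)

size-of-weight : ∀ {m} l → weight l ≡ m → 5 + tailSize l ≡ 10 + m * 2
size-of-weight l e = trans (chain-size l) (cong (λ w → 10 + w * 2) e)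

chain-embedding⇒weight : ∀ l {G : Graph n} → CubicConnPerm G → Embedding (JoinedAdj [] l) G → 10 + weight l * 2 ≡ n
chain-embedding⇒weight l {G} (conn , cubic , _) φ = trans (≡-sym (chain-size l))
  (embedding⇒≡ (chain l) G (joined-cubic [] l) cubic conn (along-decodeJ [] l φ) 0F)

classification : (G : Graph n) → 1 ≤ n → CubicConnPerm G →
  (4 ≡ n × Embedding (Adj K₄) G) ⊎ (6 ≡ n × Embedding (Adj K₃₃) G) ⊎
  (∃ λ l → 10 + weight l * 2 ≡ n × Embedding (JoinedAdj [] l) G)
classification G pos p@(conn , cubic , perm) with Classify.classify G cubic perm pos
... | Classify.found-K₄ φ = inj₁ (embedding⇒≡ K₄ G cubic-K₄ cubic conn φ 0F , φ)
... | Classify.found-K₃₃ φ = inj₂ (inj₁ (embedding⇒≡ K₃₃ G cubic-K₃₃ cubic conn φ 0F , φ))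
... | Classify.found-chain l φ = inj₂ (inj₂ (l , chain-embedding⇒weight l p φ , φ))

≈-embedding : ∀ {l z} {G : Graph n} → l ≈ z → Embedding (JoinedAdj [] l) G → Embedding (JoinedAdj [] z) G
≈-embedding (inj₁ refl) φ = φ
≈-embedding {z = z} {G} (inj₂ refl) φ =
  subst (λ k → Embedding (JoinedAdj [] k) G) (List.reverse-involutive z) (reversed (reverse z) φ)

-- Different classes of words give non-isomorphic chains by `chain-words`. Conversely
-- `classification` leaves only chains, as 4 and 6 are not of the form 10 + 2m.
count-chains : ∀ m → Counted (CubicConnPerm {10 + m * 2}) Iso (classes m)
count-chains m = count-map (λ l e → resize (size-of-weight l e) (chain l)) (count-classes m)
  (λ l e → resize-cubicConnPerm (size-of-weight l e) (chain-cubicConnPerm l))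
  (λ l l′ e e′ iso → chain-words l l′ (out-of-resize (size-of-weight l′ e′)
    (embedding-iso (into-resize (size-of-weight l e) (encoding [] l)) iso)))
  covers
  where
  covers : ∀ G → CubicConnPerm G → ∃ λ l → weight l ≡ m × (∀ z e → l ≈ z → Iso G (resize (size-of-weight z e) (chain z)))
  covers G p@(_ , cubic , _) with classification G (s≤s z≤n) p
  ... | inj₁ (() , _)
  ... | inj₂ (inj₁ (() , _))
  ... | inj₂ (inj₂ (l , e , φ)) = l , *-cancelʳ-≡ _ _ 2 (+-cancelˡ-≡ 10 _ _ e) , λ z ez l≈z →
    iso-sym {G = resize (size-of-weight z ez) (chain z)} {G} (embedding⇒Iso (resize (size-of-weight z ez) (chain z)) G
      (proj₁ (proj₂ (resize-cubicConnPerm (size-of-weight z ez) (chain-cubicConnPerm z)))) cubic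
      (from-resize (size-of-weight z ez) (along-decodeJ [] z (≈-embedding l≈z φ))))

count-order-4 : Counted (CubicConnPerm {4}) Iso 1
count-order-4 = count-one K₄ cubicConnPerm-K₄ covers
  where
  covers : ∀ G → CubicConnPerm G → Iso G K₄
  covers G p@(_ , cubic , _) with classification G (s≤s z≤n) p
  ... | inj₁ (_ , φ) = iso-sym {G = K₄} {G} (embedding⇒Iso K₄ G cubic-K₄ cubic φ)
  ... | inj₂ (inj₁ (() , _))
  ... | inj₂ (inj₂ (_ , () , _))

count-order-6 : Counted (CubicConnPerm {6}) Iso 1
count-order-6 = count-one K₃₃ cubicConnPerm-K₃₃ covers
  where
  covers : ∀ G → CubicConnPerm G → Iso G K₃₃
  covers G p@(_ , cubic , _) with classification G (s≤s z≤n) p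
  ... | inj₁ (() , _)
  ... | inj₂ (inj₁ (_ , φ)) = iso-sym {G = K₃₃} {G} (embedding⇒Iso K₃₃ G cubic-K₃₃ cubic φ)
  ... | inj₂ (inj₂ (_ , () , _))

count-other-orders : ∀ n → 1 ≤ n → 4 ≢ n → 6 ≢ n → (∀ w → 10 + w * 2 ≢ n) → Counted (CubicConnPerm {n}) Iso 0
count-other-orders n pos ≢4 ≢6 ≢10+ = count-none none
  where
  none : ∀ G → ¬ CubicConnPerm G
  none G p with classification G pos p
  ... | inj₁ (e , _) = ≢4 e
  ... | inj₂ (inj₁ (e , _)) = ≢6 e
  ... | inj₂ (inj₂ (l , e , _)) = ≢10+ (weight l) e

odd-or-2-or-8 : ∀ n → n % 2 ≡ 1 ⊎ n ≡ 2 ⊎ n ≡ 8 → 1 ≤ n → Counted (CubicConnPerm {n}) Iso 0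
odd-or-2-or-8 n (inj₁ odd) pos = count-other-orders n pos (λ { refl → 0≢1+n odd }) (λ { refl → 0≢1+n odd })
  (λ { w refl → 0≢1+n (trans (≡-sym (m*n%n≡0 (5 + w) 2)) odd) })
odd-or-2-or-8 _ (inj₂ (inj₁ refl)) pos = count-other-orders 2 pos (λ ()) (λ ()) (λ _ ())
odd-or-2-or-8 _ (inj₂ (inj₂ refl)) pos = count-other-orders 8 pos (λ ()) (λ ()) (λ _ ())

theorem1p3 : (a t : ℕ → ℕ) →
    (∀ n → 1 ≤ n → NumCubicPermClasses n (a n)) →
    (∀ x → NumCompositions23 x (t x)) →
    (∀ n → 1 ≤ n → (n % 2 ≡ 1 ⊎ n ≡ 2 ⊎ n ≡ 8 ⊎ n ≡ 12) → a n ≡ 0) ×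
    (∀ n → (n ≡ 4 ⊎ n ≡ 6 ⊎ n ≡ 10 ⊎ n ≡ 14 ⊎ n ≡ 16 ⊎ n ≡ 18 ⊎ n ≡ 20) → a n ≡ 1) ×
    (∀ n → 20 < n → n % 2 ≡ 0 →
    (n % 4 ≡ 2 → a n ≡ a (n ∸ 4) + a (n ∸ 6)) ×
    (n % 4 ≡ 0 → a n + t ((n ∸ 20) / 4) ≡ a (n ∸ 4) + a (n ∸ 6)))
theorem1p3 a t a-counts t-counts = zeros , ones , λ n 20<n _ → even n 20<n , odd n 20<n
  where
  a-value : ∀ n {k} → 1 ≤ n → Counted (CubicConnPerm {n}) Iso k → a n ≡ k
  a-value n pos c = count-unique (λ {G} {H} → iso-sym {G = G} {H}) (λ {G} {H} {K} → iso-trans {G = G} {H} {K}) (counted (a-counts n pos)) c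
  a-chains : ∀ m → a (10 + m * 2) ≡ classes m
  a-chains m = a-value (10 + m * 2) (s≤s z≤n) (count-chains m)
  -- The weights of n, n - 4 and n - 6 are `c + 2i` with `c` = 6, 4, 3 if n ≡ 2 and `c` = 7, 5, 4 if
  -- n ≡ 0 modulo 4.
  a-chains-4* : ∀ c i → a (10 + c * 2 + i * 4) ≡ classes (c + i * 2)
  a-chains-4* c i = trans (cong a (arith c i)) (a-chains (c + i * 2))
    where
    arith : ∀ c i → 10 + c * 2 + i * 4 ≡ 10 + (c + i * 2) * 2
    arith = solve-∀
  t-value : ∀ x → t x ≡ compositions x
  t-value x = count-unique ≡-sym trans (counted (t-counts x)) (count-compositions x)
  zeros : ∀ n → 1 ≤ n → (n % 2 ≡ 1 ⊎ n ≡ 2 ⊎ n ≡ 8 ⊎ n ≡ 12) → a n ≡ 0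
  zeros n pos (inj₁ p) = a-value n pos (odd-or-2-or-8 n (inj₁ p) pos)
  zeros n pos (inj₂ (inj₁ p)) = a-value n pos (odd-or-2-or-8 n (inj₂ (inj₁ p)) pos)
  zeros n pos (inj₂ (inj₂ (inj₁ p))) = a-value n pos (odd-or-2-or-8 n (inj₂ (inj₂ p)) pos)
  -- Order 12 would need a word of weight 1.
  zeros _ pos (inj₂ (inj₂ (inj₂ refl))) = a-chains 1
  ones : ∀ n → (n ≡ 4 ⊎ n ≡ 6 ⊎ n ≡ 10 ⊎ n ≡ 14 ⊎ n ≡ 16 ⊎ n ≡ 18 ⊎ n ≡ 20) → a n ≡ 1
  ones _ (inj₁ refl) = a-value 4 (s≤s z≤n) count-order-4
  ones _ (inj₂ (inj₁ refl)) = a-value 6 (s≤s z≤n) count-order-6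
  ones _ (inj₂ (inj₂ (inj₁ refl))) = a-chains 0
  ones _ (inj₂ (inj₂ (inj₂ (inj₁ refl)))) = a-chains 2
  ones _ (inj₂ (inj₂ (inj₂ (inj₂ (inj₁ refl))))) = a-chains 3
  ones _ (inj₂ (inj₂ (inj₂ (inj₂ (inj₂ (inj₁ refl)))))) = a-chains 4
  ones _ (inj₂ (inj₂ (inj₂ (inj₂ (inj₂ (inj₂ refl)))))) = a-chains 5
  2-mod-4 : ∀ {n} → 20 < n → n % 4 ≡ 2 → ∃ λ i → n ≡ 22 + i * 4
  2-mod-4 {n} 20<n e = n / 4 ∸ 5 , trans n≡ (cong (λ q → 2 + q * 4) (≡-sym (m+[n∸m]≡n 5≤)))
    where
    n≡ : n ≡ 2 + n / 4 * 4
    n≡ = trans (m≡m%n+[m/n]*n n 4) (cong (_+ n / 4 * 4) e)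
    5≤ : 5 ≤ n / 4
    -- From 21 ≤ 2 + 4q follows 19 ≤ 4q, which is weakened to 4 · 4 < 4q.
    5≤ = *-cancelʳ-< 4 4 (n / 4) (≤-trans (m≤n+m 17 2) (+-cancelˡ-≤ 2 19 (n / 4 * 4) (subst (21 ≤_) n≡ 20<n)))
  0-mod-4 : ∀ {n} → 20 < n → n % 4 ≡ 0 → ∃ λ i → n ≡ 24 + i * 4
  0-mod-4 {n} 20<n e = n / 4 ∸ 6 , trans n≡ (cong (_* 4) (≡-sym (m+[n∸m]≡n 6≤)))
    where
    n≡ : n ≡ n / 4 * 4
    n≡ = trans (m≡m%n+[m/n]*n n 4) (cong (_+ n / 4 * 4) e)
    6≤ : 6 ≤ n / 4
    6≤ = *-cancelʳ-< 4 5 (n / 4) (subst (20 <_) n≡ 20<n)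
  even : ∀ n → 20 < n → n % 4 ≡ 2 → a n ≡ a (n ∸ 4) + a (n ∸ 6)
  even n 20<n e with 2-mod-4 20<n e
  ... | i , refl = trans (a-chains-4* 6 i) (trans (classes-even i) (≡-sym (cong₂ _+_ (a-chains-4* 4 i) (a-chains-4* 3 i))))
  odd : ∀ n → 20 < n → n % 4 ≡ 0 → a n + t ((n ∸ 20) / 4) ≡ a (n ∸ 4) + a (n ∸ 6)
  odd n 20<n e with 0-mod-4 20<n e
  -- For n = 24 + 4i the argument (n - 20)/4 is `suc i`.
  ... | i , refl = trans (cong₂ _+_ (a-chains-4* 7 i) (trans (cong t (m*n/n≡m (suc i) 4)) (t-value (suc i))))
    (trans (classes-odd i) (≡-sym (cong₂ _+_ (a-chains-4* 5 i) (a-chains-4* 4 i))))
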